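{- Let $G$ be a connected nontrivial graph with $m$ vertices and let $n\geq3$. Then $$\lambda'(G\boxtimes C_n)=\min\{3n\lambda(G),\ 2(m+2e(G)),\ 6\delta(G)+2\}.$$
   Context: All graphs are finite, simple and undirected; "nontrivial" means having at least two vertices. $C_n$ denotes the cycle on $n$ vertices. For a graph $G$: $e(G)=|E(G)|$; $\delta(G)$ is the minimum degree; $\lambda(G)$ is the edge-connectivity. A restricted edge-cut of a connected graph $G$ is a set $S\subseteq E(G)$ such that $G-S$ is disconnected and every component of $G-S$ has at least $2$ vertices; the restricted edge-connectivity $\lambda'(G)$ is the minimum cardinality of a restricted edge-cut. The strong product $G\boxtimes H$ has vertex set $V(G)\times V(H)$, with $(x_1,y_1)$ and $(x_2,y_2)$ adjacent iff either $x_1=x_2$ and $y_1y_2\in E(H)$, or $y_1=y_2$ and $x_1x_2\in E(G)$, or $x_1x_2\in E(G)$ and $y_1y_2\in E(H)$. -}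

module Defs where

open import Data.Fin using (Fin; toℕ)
open import Data.Fin.Properties using (*↔×; inj⇒≟)
import Data.Fin.Properties as Fin
open import Data.List using (List; allFin; cartesianProduct; filter; length; map)
open import Data.List.Extrema.Nat using (min)
open import Data.Nat using (ℕ; suc; _*_; _≤_; s≤s)
import Data.Nat.Properties as ℕ
open import Data.Product using (_×_; _,_; Σ-syntax; ∃-syntax)
open import Data.Product.Function.NonDependent.Propositional using (_×-↔_)
open import Data.Sum using (_⊎_; inj₁; inj₂; swap)
open import Function using (_↔_; _∘_; id)
open import Function.Bundles using (Inverse)
open import Function.Construct.Composition using (_↔-∘_)
open import Function.Properties.Inverse using (↔-refl; ↔-sym; ↔⇒↣)
open import Relation.Binary.Construct.Closure.ReflexiveTransitive using (Star)
open import Relation.Binary.Definitions using (Decidable; DecidableEquality; Irreflexive; Symmetric)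
open import Relation.Binary.PropositionalEquality using (_≡_; _≢_; refl; sym; trans; cong)
open import Relation.Nullary using (¬_)
open import Relation.Nullary.Decidable using (_×-dec_; _⊎-dec_; ¬?)

record Graph : Set₁ where
  infix 4 _~_ _~?_
  field
    Vertex      : Set
    order       : ℕ
    enumeration : Fin order ↔ Vertex
    _~_         : Vertex → Vertex → Set
    _~?_        : Decidable _~_
    ~-sym       : Symmetric _~_
    ~-irrefl    : Irreflexive _≡_ _~_

  vertex : Fin order → Vertex
  vertex = Inverse.to enumeration

  vertices : List Vertex
  vertices = map vertex (allFin order)

  _≟_ : DecidableEquality Vertex
  _≟_ = inj⇒≟ (↔⇒↣ (↔-sym enumeration))

  degree : Vertex → ℕ
  degree u = length (filter (u ~?_) vertices)

open Graph

-- A set of edges is given by its symmetric membership relation on ordered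
-- pairs: the edge uv belongs to S when `Member S u v` (equivalently
-- `Member S v u`) holds.
record EdgeSet (G : Graph) : Set₁ where
  field
    Member     : Vertex G → Vertex G → Set
    member?    : Decidable Member
    member-sym : Symmetric Member
    member⇒~   : ∀ {u v} → Member u v → _~_ G u v

open EdgeSet

-- Each edge is counted once, as the pair of its ends in increasing order of
-- their position in the enumeration.
∣_∣ : {G : Graph} → EdgeSet G → ℕ
∣_∣ {G} S = length (filter
  (λ (i , j) → i Fin.<? j ×-dec member? S (vertex G i) (vertex G j))
  (cartesianProduct (allFin (order G)) (allFin (order G))))

E : (G : Graph) → EdgeSet G
E G = record
  { Member     = _~_ G
  ; member?    = _~?_ G
  ; member-sym = ~-sym G
  ; member⇒~   = id
  }

e : Graph → ℕ
e G = ∣ E G ∣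

-- The default value `order G` exceeds every degree, so it only matters for the
-- graph without vertices.
δ : Graph → ℕ
δ G = min (order G) (map (degree G) (vertices G))

infixl 6 _−_
_−_ : (G : Graph) → EdgeSet G → Graph
G − S = record
  { Vertex      = Vertex G
  ; order       = order G
  ; enumeration = enumeration G
  ; _~_         = λ u v → _~_ G u v × ¬ Member S u v
  ; _~?_        = λ u v → _~?_ G u v ×-dec ¬? (member? S u v)
  ; ~-sym       = λ (u~v , uv∉S) → ~-sym G u~v , uv∉S ∘ member-sym S
  ; ~-irrefl    = λ u≡v (u~v , _) → ~-irrefl G u≡v u~v
  }

Component : (G : Graph) → Vertex G → Vertex G → Set
Component G u v = Star (_~_ G) u v

Connected : Graph → Set
Connected G = ∀ u v → Component G u v

Disconnected : Graph → Set
Disconnected G = ¬ Connected G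

Nontrivial : Graph → Set
Nontrivial G = 2 ≤ order G

AtLeastTwo : {A : Set} → (A → Set) → Set
AtLeastTwo P = ∃[ x ] ∃[ y ] (x ≢ y × P x × P y)

IsEdgeCut : (G : Graph) → EdgeSet G → Set
IsEdgeCut G S = Disconnected (G − S)

IsRestrictedEdgeCut : (G : Graph) → EdgeSet G → Set
IsRestrictedEdgeCut G S =
  Disconnected (G − S) × (∀ u → AtLeastTwo (Component (G − S) u))

IsMinimumCardinality : {G : Graph} → (EdgeSet G → Set) → ℕ → Set₁
IsMinimumCardinality {G} P k =
  (Σ[ S ∈ EdgeSet G ] (P S × ∣ S ∣ ≡ k)) × (∀ S → P S → k ≤ ∣ S ∣)

-- λ(G) = k and λ′(G) = k.
IsEdgeConnectivity : Graph → ℕ → Set₁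
IsEdgeConnectivity G = IsMinimumCardinality (IsEdgeCut G)

IsRestrictedEdgeConnectivity : Graph → ℕ → Set₁
IsRestrictedEdgeConnectivity G = IsMinimumCardinality (IsRestrictedEdgeCut G)

-- j is the cyclic successor of i on 0, 1, …, n - 1.
Next : {n : ℕ} → Fin n → Fin n → Set
Next {n} i j = suc (toℕ i) ≡ toℕ j ⊎ (suc (toℕ i) ≡ n × toℕ j ≡ 0)

next? : {n : ℕ} → Decidable (Next {n})
next? {n} i j =
  (suc (toℕ i) ℕ.≟ toℕ j) ⊎-dec ((suc (toℕ i) ℕ.≟ n) ×-dec (toℕ j ℕ.≟ 0))

next-irrefl : {n : ℕ} → 3 ≤ n → (i : Fin n) → ¬ Next i i
next-irrefl _   i (inj₁ 1+i≡i) = ℕ.1+n≢n 1+i≡i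
next-irrefl 3≤n i (inj₂ (1+i≡n , i≡0))
  with s≤s () ← ℕ.≤-trans 3≤n (ℕ.≤-reflexive (trans (sym 1+i≡n) (cong suc i≡0)))

cycle : (n : ℕ) → 3 ≤ n → Graph
cycle n 3≤n = record
  { Vertex      = Fin n
  ; order       = n
  ; enumeration = ↔-refl
  ; _~_         = λ i j → Next i j ⊎ Next j i
  ; _~?_        = λ i j → next? i j ⊎-dec next? j i
  ; ~-sym       = swap
  ; ~-irrefl    = λ { {i} refl (inj₁ p) → next-irrefl 3≤n i p
                    ; {i} refl (inj₂ p) → next-irrefl 3≤n i p }
  }

infixl 7 _⊠_
_⊠_ : Graph → Graph → Graph
G ⊠ H = record
  { Vertex      = Vertex G × Vertex H
  ; order       = order G * order H
  ; enumeration = (enumeration G ×-↔ enumeration H) ↔-∘ *↔×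
  ; _~_         = λ (x₁ , y₁) (x₂ , y₂) →
      (x₁ ≡ x₂ × y₁ ~ᴴ y₂) ⊎ (y₁ ≡ y₂ × x₁ ~ᴳ x₂) ⊎ (x₁ ~ᴳ x₂ × y₁ ~ᴴ y₂)
  ; _~?_        = λ (x₁ , y₁) (x₂ , y₂) →
      (_≟_ G x₁ x₂ ×-dec _~?_ H y₁ y₂) ⊎-dec
      ((_≟_ H y₁ y₂ ×-dec _~?_ G x₁ x₂) ⊎-dec
       (_~?_ G x₁ x₂ ×-dec _~?_ H y₁ y₂))
  ; ~-sym       = λ
      { (inj₁ (p , q))        → inj₁ (sym p , ~-sym H q)
      ; (inj₂ (inj₁ (p , q))) → inj₂ (inj₁ (sym p , ~-sym G q))
      ; (inj₂ (inj₂ (p , q))) → inj₂ (inj₂ (~-sym G p , ~-sym H q)) }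
  ; ~-irrefl    = λ
      { refl (inj₁ (_ , q))        → ~-irrefl H refl q
      ; refl (inj₂ (inj₁ (_ , q))) → ~-irrefl G refl q
      ; refl (inj₂ (inj₂ (p , _))) → ~-irrefl G refl p }
  }
  where
  _~ᴳ_ = _~_ G
  _~ᴴ_ = _~_ H

{-# OPTIONS --safe #-}
-- Twice the number of edges leaving a vertex set X of G ⊠ Cₙ is a sum over the columns {x} × Cₙ (the
-- boundary of X in the column) and over the ordered pairs of adjacent columns.  Call a column mixed if
-- it meets both X and its complement.  A mixed column has boundary at least 2; two adjacent columns
-- span at least 4 cut edges if both are mixed, and 3|P| if one meets X in P and the other is disjoint
-- from X.  Hence, for a set X that is a side of a restricted edge-cut:
--   * if some column is full and some is empty, every layer is an edge-cut of G and the diagonals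
--     between two consecutive layers cost two edge-cuts of G, which gives 3nλ(G);
--   * if all columns are mixed, there are at least 2m + 4e(G) cut edges;
--   * otherwise, up to complement, no column is full and some column is mixed.  Two mixed columns
--     already give 2·2 + 2·3δ(G) − 2 cut edges; a single mixed column contains two vertices of X,
--     hence at least 2 + 6δ(G) cut edges.
-- The bounds are attained by the lift of a minimum edge-cut of G, by the boundary of a layer, and by
-- the boundary of an edge of Cₙ over a vertex of minimum degree.
module Submission where

open import Defs
open import Data.Bool using (Bool; true; false; not; _∧_; _∨_; if_then_else_)
import Data.Bool.Properties as Bool
open import Data.Fin using (Fin; zero; suc; toℕ; fromℕ; fromℕ<; inject₁; combine; remQuot; _↑ˡ_; _↑ʳ_)
open import Data.Fin.Induction using (<-weakInduction; >-weakInduction)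
open import Data.Fin.Permutation using (permutation)
import Data.Fin.Properties as Fin
open import Data.Fin.Relation.Unary.Top using (view; ‵fromℕ; ‵inject₁; view-fromℕ; view-inject₁)
open import Data.List using (List; []; _∷_; _++_; length; filter; map; tabulate; allFin; cartesianProduct)
open import Data.List.Extrema.Nat using (argmin-sel; min≤xs)
open import Data.List.Membership.Propositional.Properties using (∈-map⁻)
open import Data.List.Properties using (filter-++; length-++; length-filter; length-map; length-tabulate; map-tabulate)
open import Data.List.Relation.Unary.All using (All; []; _∷_)
import Data.List.Relation.Unary.All.Properties as All
open import Data.List.Relation.Unary.AllPairs using ([]; _∷_)
open import Data.List.Relation.Unary.Unique.Propositional using (Unique)
open import Data.Nat using (ℕ; zero; suc; _+_; _*_; _≤_; _⊓_; _≤?_; z≤n; s≤s)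
import Data.Nat.ListAction as List
open import Data.Nat.Properties hiding (_≟_; _≤?_)
open import Data.Nat.Tactic.RingSolver using (solve-∀)
open import Data.Product using (_×_; _,_; ∃; Σ-syntax; proj₁; proj₂)
open import Data.Sum using (_⊎_; inj₁; inj₂)
open import Effect.Monad using (RawMonad)
open import Function using (_∘_; _$_; id)
open import Function.Bundles using (Inverse; mk⇔)
open import Relation.Binary.Construct.Closure.ReflexiveTransitive as Star using (ε; _◅_; _◅◅_)
open import Relation.Binary.Definitions using (Symmetric; tri<; tri≈; tri>) renaming (Decidable to Decidable₂)
open import Relation.Binary.PropositionalEquality
open import Relation.Nullary using (Dec; does; yes; no; ¬_; contradiction)
open import Relation.Nullary.Decidable using (_×-dec_; ¬?; dec-true; dec-false; decidable-stable; does-⇔; ¬¬-excluded-middle)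
open import Relation.Nullary.Negation using (¬¬-Monad; ¬¬-map)
open import Relation.Unary using (Pred; Decidable)
open import Algebra.Properties.Semiring.Sum +-*-semiring

open Graph
open EdgeSet

-- Finite sums

ind : Bool → ℕ
ind b = if b then 1 else 0

ind-∧ : ∀ a b → ind (a ∧ b) ≡ ind a * ind b
ind-∧ false b = refl
ind-∧ true  b = sym (+-identityʳ (ind b))

sum-mono : ∀ {n} {f g : Fin n → ℕ} → (∀ i → f i ≤ g i) → sum f ≤ sum g
sum-mono {zero}  f≤g = z≤n
sum-mono {suc n} f≤g = +-mono-≤ (f≤g zero) (sum-mono (f≤g ∘ suc))

sum-const : ∀ n c → ∑[ i < n ] c ≡ n * c
sum-const zero    c = refl
sum-const (suc n) c = cong (c +_) (sum-const n c)

∑-distrib-+₃ : ∀ {n} (f g h : Fin n → ℕ) → ∑[ i < n ] (f i + (g i + h i)) ≡ sum f + (sum g + sum h)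
∑-distrib-+₃ f g h = trans (∑-distrib-+ f _) (cong (sum f +_) (∑-distrib-+ g h))

-- The predicate `P` is arbitrary with `a` as its only witness, so that equality of indices,
-- equality of vertices and `Next` can all be collapsed in this way.
sum-select : ∀ {n p} {P : Pred (Fin n) p} (P? : Decidable P) (f : Fin n → ℕ) (a : Fin n) →
             P a → (∀ {i} → P i → i ≡ a) → ∑[ i < n ] (ind (does (P? i)) * f i) ≡ f a
sum-select {suc n} P? f zero Pa P⇒≡ = begin
  ind (does (P? zero)) * f zero + ∑[ i < n ] (ind (does (P? (suc i))) * f (suc i))
    ≡⟨ cong₂ _+_ (cong (λ b → ind b * f zero) (dec-true (P? zero) Pa)) (sum-cong-≗ λ i →
         cong (λ b → ind b * f (suc i)) (dec-false (P? (suc i)) λ Pi → contradiction (P⇒≡ Pi) λ ())) ⟩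
  1 * f zero + ∑[ i < n ] 0
    ≡⟨ cong₂ _+_ (*-identityˡ (f zero)) (sum-const n 0) ⟩
  f zero + n * 0
    ≡⟨ cong (f zero +_) (*-zeroʳ n) ⟩
  f zero + 0
    ≡⟨ +-identityʳ (f zero) ⟩
  f zero ∎
  where open ≡-Reasoning
sum-select {suc n} P? f (suc a) Pa P⇒≡ = cong₂ _+_
  (cong (λ b → ind b * f zero) (dec-false (P? zero) λ P0 → contradiction (P⇒≡ P0) λ ()))
  (sum-select (P? ∘ suc) (f ∘ suc) a Pa (Fin.suc-injective ∘ P⇒≡))

-- Induction on the list: `g` is `f` with its value at the head `a` replaced by 0, which the tail
-- does not notice because it avoids `a`.
sum-unique-≤ : ∀ {n} (f : Fin n → ℕ) {xs : List (Fin n)} → Unique xs → List.sum (map f xs) ≤ sum f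
sum-unique-≤ f []                   = z≤n
sum-unique-≤ {n} f {a ∷ xs} (a∉xs ∷ xs!) = begin
  f a + List.sum (map f xs)        ≡⟨ cong (λ ys → f a + List.sum ys) (map-agree a∉xs) ⟩
  f a + List.sum (map g xs)        ≤⟨ +-monoʳ-≤ (f a) (sum-unique-≤ g xs!) ⟩
  f a + sum g                      ≡⟨ cong (_+ sum g) (sum-select (Fin._≟ a) f a refl id) ⟨
  ∑[ i < n ] (ind (does (i Fin.≟ a)) * f i) + sum g
                                   ≡⟨ ∑-distrib-+ _ g ⟨
  ∑[ i < n ] (ind (does (i Fin.≟ a)) * f i + g i)
                                   ≡⟨ sum-cong-≗ (λ i → split (does (i Fin.≟ a)) (f i)) ⟩
  sum f                            ∎
  where
  open ≤-Reasoning
  g : Fin n → ℕ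
  g i = ind (not (does (i Fin.≟ a))) * f i
  split : ∀ b x → ind b * x + ind (not b) * x ≡ x
  split false x = +-identityʳ x
  split true  x = trans (+-identityʳ (x + 0)) (+-identityʳ x)
  map-agree : ∀ {ys} → All (a ≢_) ys → map f ys ≡ map g ys
  map-agree [] = refl
  map-agree {y ∷ _} (a≢y ∷ a∉ys) = cong₂ _∷_
    (sym (trans (cong (λ b → ind (not b) * f y) (dec-false (y Fin.≟ a) (a≢y ∘ sym))) (+-identityʳ (f y))))
    (map-agree a∉ys)

sum-+ : ∀ m n (f : Fin (m + n) → ℕ) → sum f ≡ ∑[ i < m ] f (i ↑ˡ n) + ∑[ j < n ] f (m ↑ʳ j)
sum-+ zero    n f = refl
sum-+ (suc m) n f = trans (cong (f zero +_) (sum-+ m n (f ∘ suc))) (sym (+-assoc (f zero) _ _))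

-- Turns sums over the vertices of a strong product into iterated sums, since its enumeration
-- decodes an index by `remQuot`.
sum-* : ∀ m n (f : Fin m × Fin n → ℕ) →
        ∑[ k < m * n ] f (remQuot n k) ≡ ∑[ i < m ] ∑[ j < n ] f (i , j)
sum-* m n f = trans (sum-combine m (f ∘ remQuot n))
  (sum-cong-≗ λ i → sum-cong-≗ λ j → cong f (Fin.remQuot-combine i j))
  where
  sum-combine : ∀ m (g : Fin (m * n) → ℕ) → sum g ≡ ∑[ i < m ] ∑[ j < n ] g (combine i j)
  sum-combine zero    g = refl
  sum-combine (suc m) g =
    trans (sum-+ n (m * n) g) (cong (∑[ j < n ] g (j ↑ˡ (m * n)) +_) (sum-combine m (g ∘ (n ↑ʳ_))))

length-filter-tabulate : ∀ {a p n} {A : Set a} {P : Pred A p} (P? : Decidable P) (g : Fin n → A) →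
                         length (filter P? (tabulate g)) ≡ ∑[ i < n ] ind (does (P? (g i)))
length-filter-tabulate {n = zero}  P? g = refl
length-filter-tabulate {n = suc n} P? g with does (P? (g zero))
... | true  = cong suc (length-filter-tabulate P? (g ∘ suc))
... | false = length-filter-tabulate P? (g ∘ suc)

length-filter-cartesianProduct :
  ∀ {a b p m n} {A : Set a} {B : Set b} {P : Pred (A × B) p} (P? : Decidable P) (f : Fin m → A) (g : Fin n → B) →
  length (filter P? (cartesianProduct (tabulate f) (tabulate g))) ≡
  ∑[ i < m ] ∑[ j < n ] ind (does (P? (f i , g j)))
length-filter-cartesianProduct {m = zero}  P? f g = refl
length-filter-cartesianProduct {m = suc m} {n} P? f g = begin
  length (filter P? (map (f zero ,_) (tabulate g) ++ rest))
    ≡⟨ cong length (filter-++ P? (map (f zero ,_) (tabulate g)) rest) ⟩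
  length (filter P? (map (f zero ,_) (tabulate g)) ++ filter P? rest)
    ≡⟨ length-++ (filter P? (map (f zero ,_) (tabulate g))) ⟩
  length (filter P? (map (f zero ,_) (tabulate g))) + length (filter P? rest)
    ≡⟨ cong₂ _+_ (trans (cong (length ∘ filter P?) (map-tabulate g (f zero ,_)))
                        (length-filter-tabulate P? (λ j → f zero , g j)))
                 (length-filter-cartesianProduct P? (f ∘ suc) g) ⟩
  ∑[ j < n ] ind (does (P? (f zero , g j))) + ∑[ i < m ] ∑[ j < n ] ind (does (P? (f (suc i) , g j))) ∎
  where
  open ≡-Reasoning
  rest = cartesianProduct (tabulate (f ∘ suc)) (tabulate g)

-- Exchanging the indices in one of two copies of the sum turns `i < j` into `j < i`; by trichotomy
-- the two copies cover all pairs off the diagonal.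
sum-symmetric : ∀ {n} (r : Fin n → Fin n → ℕ) → (∀ i j → r i j ≡ r j i) → (∀ i → r i i ≡ 0) →
                2 * ∑[ i < n ] ∑[ j < n ] (ind (does (i Fin.<? j)) * r i j) ≡ ∑[ i < n ] ∑[ j < n ] r i j
sum-symmetric {n} r r-sym r-irrefl = begin
  2 * upper
    ≡⟨ cong (upper +_) (+-identityʳ upper) ⟩
  upper + upper
    ≡⟨ cong (upper +_) (trans (∑-comm {n} {n} _) (sum-cong-≗ λ i → sum-cong-≗ λ j →
         cong (ind (does (j Fin.<? i)) *_) (r-sym j i))) ⟩
  upper + ∑[ i < n ] ∑[ j < n ] (ind (does (j Fin.<? i)) * r i j)
    ≡⟨ ∑-distrib-+ {n} _ _ ⟨
  ∑[ i < n ] (∑[ j < n ] (ind (does (i Fin.<? j)) * r i j) + ∑[ j < n ] (ind (does (j Fin.<? i)) * r i j))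
    ≡⟨ sum-cong-≗ (λ i → trans (sym (∑-distrib-+ {n} _ _)) (sum-cong-≗ (split i))) ⟩
  ∑[ i < n ] ∑[ j < n ] r i j ∎
  where
  open ≡-Reasoning
  upper = ∑[ i < n ] ∑[ j < n ] (ind (does (i Fin.<? j)) * r i j)
  split : ∀ i j → ind (does (i Fin.<? j)) * r i j + ind (does (j Fin.<? i)) * r i j ≡ r i j
  split i j with Fin.<-cmp i j
  ... | tri< i<j _ j≮i rewrite dec-true (i Fin.<? j) i<j | dec-false (j Fin.<? i) j≮i =
    trans (+-identityʳ _) (+-identityʳ _)
  ... | tri≈ i≮j refl _ rewrite dec-false (i Fin.<? i) i≮j = sym (r-irrefl i)
  ... | tri> i≮j _ j<i rewrite dec-false (i Fin.<? j) i≮j | dec-true (j Fin.<? i) j<i = +-identityʳ _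

-- Subsets of a cycle

-- Written with `¬?` so that it agrees by computation with the indicator of the condition that
-- defines the boundary `∂` of a vertex set.
dist : Bool → Bool → ℕ
dist a b = ind (does (¬? (a Bool.≟ b)))

dist-comm : ∀ a b → dist a b ≡ dist b a
dist-comm false false = refl
dist-comm false true  = refl
dist-comm true  false = refl
dist-comm true  true  = refl

prev : ∀ {n} → Fin (suc n) → Fin (suc n)
prev zero    = fromℕ _
prev (suc i) = inject₁ i

next : ∀ {n} → Fin (suc n) → Fin (suc n)
next i with view i
next {zero}  _ | _          = zero
next {suc n} _ | ‵fromℕ     = zero
next {suc n} _ | ‵inject₁ j = suc j

prev-next : ∀ {n} (i : Fin (suc n)) → prev (next i) ≡ i
prev-next {zero} zero = refl
prev-next {suc n} i with view i
... | ‵fromℕ     = refl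
... | ‵inject₁ j = refl

next-prev : ∀ {n} (i : Fin (suc n)) → next (prev i) ≡ i
next-prev {zero}  zero = refl
next-prev {suc n} zero    rewrite view-fromℕ n = refl
next-prev {suc n} (suc i) rewrite view-inject₁ i = refl

prev-injective : ∀ {n} {i j : Fin (suc n)} → prev i ≡ prev j → i ≡ j
prev-injective {i = i} {j} eq = trans (sym (next-prev i)) (trans (cong next eq) (next-prev j))

-- This is where the cycle has to have three vertices: i - 1 and i + 1 are then distinct, so windows
-- of three consecutive points have no repetition and no pair is adjacent in both directions.
prev²≢id : ∀ {n} (i : Fin (3 + n)) → prev (prev i) ≢ i
prev²≢id zero          = λ ()
prev²≢id (suc zero)    = λ ()
prev²≢id (suc (suc i)) eq = m≢1+n+m (toℕ i)
  (trans (sym (trans (Fin.toℕ-inject₁ (inject₁ i)) (Fin.toℕ-inject₁ i))) (cong toℕ eq))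

next²≢id : ∀ {n} (i : Fin (3 + n)) → next (next i) ≢ i
next²≢id i eq = prev²≢id i (trans (cong (prev ∘ prev) (sym eq))
  (trans (cong prev (prev-next (next i))) (prev-next i)))

sum-prev : ∀ {n} (f : Fin (suc n) → ℕ) → ∑[ i < suc n ] f (prev i) ≡ sum f
sum-prev f = sym (∑-permute f (permutation prev next prev-next next-prev))

module _ {n : ℕ} where

  private
    N = 3 + n

  Step : Bool → (Fin N → Bool) → Fin N → Set
  Step b P a = P (prev a) ≡ b × P a ≡ not b

  -- Without such a step the value `b` at 0 would propagate forwards to all points, contradicting
  -- `P j`; a value other than `b` at 0 would propagate backwards around the cycle, contradicting
  -- `P i`.
  step-exists : ∀ b (P : Fin N → Bool) {i j} → P i ≡ b → P j ≡ not b → ∃ (Step b P)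
  step-exists b P {i} {j} Pi Pj with Fin.any? (λ a → (P (prev a) Bool.≟ b) ×-dec (P a Bool.≟ not b))
  ... | yes step  = step
  ... | no ¬step with P zero Bool.≟ b
  ... | yes P0≡b = contradiction Pj
    (Bool.not-¬ (<-weakInduction (λ i → P i ≡ b) P0≡b (λ i → forward (suc i)) j))
    where
    forward : ∀ a → P (prev a) ≡ b → P a ≡ b
    forward a Pp with P a Bool.≟ b
    ... | yes Pa = Pa
    ... | no  Pa = contradiction (a , Pp , Bool.¬-not Pa) ¬step
  ... | no P0≢b  = contradiction Pi (>-weakInduction (λ i → P i ≢ b) (backward zero P0≢b) (λ i → backward (suc i)) i)
    where
    backward : ∀ a → P a ≢ b → P (prev a) ≢ b
    backward a Pa Pp = ¬step (a , Pp , Bool.¬-not Pa)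

  boundary : (Fin N → Bool) → ℕ
  boundary P = ∑[ i < N ] dist (P (prev i)) (P i)

  -- The number of cut edges between two adjacent columns that meet X in `P` and `Q`: one level edge
  -- for each point and two diagonals for each edge of the cycle.
  cross : (Fin N → Bool) → (Fin N → Bool) → ℕ
  cross P Q = ∑[ i < N ] (dist (P i) (Q i) + (dist (P (prev i)) (Q i) + dist (P i) (Q (prev i))))

  -- The share of cross P Q at Q k: it is positive as soon as P is not constant on {k − 1, k, k + 1}.
  cost : (Fin N → Bool) → (Fin N → Bool) → Fin N → ℕ
  cost P Q k = dist (P k) (Q k) + (dist (P (prev k)) (Q k) + dist (P (next k)) (Q k))

  -- Only the third summand differs; shifting its index once around the cycle identifies the two
  -- forms.
  sum-cost : ∀ P Q → ∑[ k < N ] cost P Q k ≡ cross P Q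
  sum-cost P Q = begin
    ∑[ k < N ] (same k + (back k + dist (P (next k)) (Q k)))
      ≡⟨ ∑-distrib-+₃ same back (λ k → dist (P (next k)) (Q k)) ⟩
    sum same + (sum back + ∑[ k < N ] dist (P (next k)) (Q k))
      ≡⟨ cong (λ x → sum same + (sum back + x)) (trans
           (sym (sum-prev (λ k → dist (P (next k)) (Q k))))
           (sum-cong-≗ λ k → cong (λ l → dist (P l) (Q (prev k))) (next-prev k))) ⟩
    sum same + (sum back + ∑[ k < N ] dist (P k) (Q (prev k)))
      ≡⟨ ∑-distrib-+₃ same back (λ k → dist (P k) (Q (prev k))) ⟨
    cross P Q ∎
    where
    open ≡-Reasoning
    same back : Fin N → ℕ
    same k = dist (P k) (Q k)
    back k = dist (P (prev k)) (Q k)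

  cross-comm : ∀ P Q → cross P Q ≡ cross Q P
  cross-comm P Q = sum-cong-≗ λ i → cong₂ _+_ (dist-comm (P i) (Q i))
    (trans (cong₂ _+_ (dist-comm (P (prev i)) (Q i)) (dist-comm (P i) (Q (prev i))))
           (+-comm (dist (Q i) (P (prev i))) _))

  cross-≥ : ∀ P Q {xs} → Unique xs → List.sum (map (cost P Q) xs) ≤ cross P Q
  cross-≥ P Q xs! = ≤-trans (sum-unique-≤ (cost P Q) xs!) (≤-reflexive (sum-cost P Q))

  value-≢ : ∀ (P : Fin N → Bool) {b i j} → P i ≡ b → P j ≡ not b → i ≢ j
  value-≢ P Pi Pj refl = Bool.not-¬ Pi Pj

  -- The window at `a` contains `prev a` and `a`, where `P` takes both values, so at one of them it
  -- differs from `Q a`. The window at `prev a` contains the same two points, which gives the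
  -- companion bound below.
  step⇒1≤cost : ∀ {b} P Q {a} → Step b P a → 1 ≤ cost P Q a
  step⇒1≤cost {b} P Q {a} (Pp , Pa) rewrite Pp | Pa = lemma b (Q a)
    where
    lemma : ∀ b q {r} → 1 ≤ dist (not b) q + (dist b q + r)
    lemma false false = s≤s z≤n
    lemma false true  = s≤s z≤n
    lemma true  false = s≤s z≤n
    lemma true  true  = s≤s z≤n

  step⇒1≤cost-prev : ∀ {b} P Q {a} → Step b P a → 1 ≤ cost P Q (prev a)
  step⇒1≤cost-prev {b} P Q {a} (Pp , Pa) rewrite next-prev a | Pp | Pa =
    lemma b (Q (prev a)) (dist (P (prev (prev a))) (Q (prev a)))
    where
    lemma : ∀ b q r → 1 ≤ dist b q + (r + dist (not b) q)
    lemma false false r = m≤n+m 1 r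
    lemma false true  r = s≤s z≤n
    lemma true  false r = s≤s z≤n
    lemma true  true  r = m≤n+m 1 r

  Mixed : (Fin N → Bool) → Set
  Mixed P = ∀ b → ∃ λ i → P i ≡ b

  -- Going around the cycle, `P` has a step in each direction, and the two steps lie at different
  -- points because `P` has different values there.
  boundary-mixed : ∀ P → Mixed P → 2 ≤ boundary P
  boundary-mixed P mixed
    with a , Ppa , Pa ← step-exists false P (proj₂ (mixed false)) (proj₂ (mixed true))
       | c , Ppc , Pc ← step-exists true P (proj₂ (mixed true)) (proj₂ (mixed false)) =
    ≤-trans (≤-reflexive (cong₂ (λ x y → x + (y + 0)) (at Ppa Pa) (at Ppc Pc)))
            (sum-unique-≤ (λ i → dist (P (prev i)) (P i)) ((value-≢ P Pa Pc ∷ []) ∷ [] ∷ []))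
    where
    dist-step : ∀ b → 1 ≡ dist b (not b)
    dist-step false = refl
    dist-step true  = refl
    at : ∀ {b i} → P (prev i) ≡ b → P i ≡ not b → 1 ≡ dist (P (prev i)) (P i)
    at {b} Pp Pi = trans (dist-step b) (sym (cong₂ dist Pp Pi))

  -- Each step makes the windows at both of its ends cost at least 1; distinctness lets the four
  -- costs be added.
  two-steps : ∀ {b c} P Q {a k} → Step b P a → Step c P k →
              Unique (a ∷ prev a ∷ k ∷ prev k ∷ []) → 4 ≤ cross P Q
  two-steps P Q sa sk distinct = ≤-trans
    (+-mono-≤ (step⇒1≤cost P Q sa) (+-mono-≤ (step⇒1≤cost-prev P Q sa)
      (+-mono-≤ (step⇒1≤cost P Q sk) (+-mono-≤ (step⇒1≤cost-prev P Q sk) z≤n))))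
    (cross-≥ P Q distinct)

  -- Two steps in the same direction cannot share an end, since the value after one is not the value
  -- before the other.
  two-equal-steps : ∀ {b} P Q {a k} → Step b P a → Step b P k → a ≢ k → 4 ≤ cross P Q
  two-equal-steps P Q sa@(Ppa , Pa) sk@(Ppk , Pk) a≢k = two-steps P Q sa sk
    ( (≢-sym (value-≢ P Ppa Pa) ∷ a≢k ∷ ≢-sym (value-≢ P Ppk Pa) ∷ [])
    ∷ (value-≢ P Ppa Pk ∷ a≢k ∘ prev-injective ∷ [])
    ∷ (≢-sym (value-≢ P Ppk Pk) ∷ []) ∷ [] ∷ [])

  -- The windows at `prev t`, `t` and `next t` give 3. The fourth unit comes from a second step of
  -- `P`, or, if `P` takes the value `not b` only at `t`, from the point `k` of `Q`.
  cross-isolated : ∀ {b} P Q {t} → P (prev t) ≡ b → P t ≡ not b → P (next t) ≡ b →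
                   (∃ λ k → Q k ≡ not b) → 4 ≤ cross P Q
  cross-isolated {b} P Q {t} Pp Pt Pn (k , Qk)
    with Fin.any? (λ k → ¬? (k Fin.≟ t) ×-dec (P k Bool.≟ not b))
  ... | yes (l , l≢t , Pl) = another-step (step-exists b P′ P′p P′l)
    where
    -- P with its value at t flipped: a step of P′ is a step of P other than t.
    P′ : Fin N → Bool
    P′ i = if does (i Fin.≟ t) then b else P i
    P′-t : P′ t ≡ b
    P′-t rewrite dec-true (t Fin.≟ t) refl = refl
    P′-other : ∀ {i} → i ≢ t → P′ i ≡ P i
    P′-other {i} i≢t rewrite dec-false (i Fin.≟ t) i≢t = refl
    P′p : P′ (prev t) ≡ b
    P′p = trans (P′-other (value-≢ P Pp Pt)) Pp
    P′l : P′ l ≡ not b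
    P′l = trans (P′-other l≢t) Pl
    another-step : ∃ (Step b P′) → 4 ≤ cross P Q
    another-step (a , P′pa , P′a) = two-equal-steps P Q (Pp , Pt) (trans (sym (P′-other pa≢t)) P′pa , Pa) (≢-sym a≢t)
      where
      a≢t : a ≢ t
      a≢t = ≢-sym (value-≢ P′ P′-t P′a)
      Pa : P a ≡ not b
      Pa = trans (sym (P′-other a≢t)) P′a
      pa≢t : prev a ≢ t
      pa≢t eq = value-≢ P Pn Pa (trans (cong next (sym eq)) (next-prev a))
  ... | no ¬other = singleton (k Fin.≟ t) (k Fin.≟ prev t) (k Fin.≟ next t)
    where
    P-other : ∀ {i} → i ≢ t → P i ≡ b
    P-other {i} i≢t with P i Bool.≟ b
    ... | yes Pi = Pi
    ... | no  Pi = contradiction (i , i≢t , Bool.¬-not Pi) ¬other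
    t≢p : t ≢ prev t
    t≢p = ≢-sym (value-≢ P Pp Pt)
    t≢n : t ≢ next t
    t≢n = ≢-sym (value-≢ P Pn Pt)
    p≢n : prev t ≢ next t
    p≢n eq = next²≢id t (trans (cong next (sym eq)) (next-prev t))
    near! : Unique (t ∷ prev t ∷ next t ∷ [])
    near! = (t≢p ∷ t≢n ∷ []) ∷ (p≢n ∷ []) ∷ [] ∷ []
    cost-t : 1 ≤ cost P Q t
    cost-t = step⇒1≤cost P Q (Pp , Pt)
    cost-p : 1 ≤ cost P Q (prev t)
    cost-p = step⇒1≤cost-prev P Q (Pp , Pt)
    cost-n : 1 ≤ cost P Q (next t)
    cost-n = step⇒1≤cost {not b} P Q
      (trans (cong P (prev-next t)) Pt , trans Pn (sym (Bool.not-involutive b)))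
    dist-≢ : ∀ {i} → P i ≡ b → 1 ≤ dist (P i) (Q k)
    dist-≢ Pi rewrite Pi | Qk = lemma b
      where
      lemma : ∀ b → 1 ≤ dist b (not b)
      lemma false = s≤s z≤n
      lemma true  = s≤s z≤n
    -- If `k` is one of the three points near `t`, its window contains two points where `P` has the
    -- value `b`, so its cost rises to 2; any other `k` supplies a fourth window.
    singleton : Dec (k ≡ t) → Dec (k ≡ prev t) → Dec (k ≡ next t) → 4 ≤ cross P Q
    singleton (yes refl) _ _ = ≤-trans
      (+-mono-≤ (≤-trans (+-mono-≤ (dist-≢ Pp) (dist-≢ Pn)) (m≤n+m _ (dist (P k) (Q k))))
        (+-mono-≤ cost-p (+-mono-≤ cost-n z≤n)))
      (cross-≥ P Q near!)
    singleton _ (yes refl) _ = ≤-trans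
      (+-mono-≤ cost-t (+-mono-≤ (+-mono-≤ (dist-≢ Pp)
        (≤-trans (dist-≢ (P-other (prev²≢id t))) (m≤m+n _ (dist (P (next (prev t))) (Q k)))))
        (+-mono-≤ cost-n z≤n)))
      (cross-≥ P Q near!)
    singleton _ _ (yes refl) = ≤-trans
      (+-mono-≤ cost-t (+-mono-≤ cost-p (+-mono-≤ (+-mono-≤ (dist-≢ Pn)
        (≤-trans (dist-≢ (P-other (next²≢id t))) (m≤n+m _ (dist (P (prev (next t))) (Q k))))) z≤n)))
      (cross-≥ P Q near!)
    singleton (no k≢t) (no k≢p) (no k≢n) = ≤-trans
      (+-mono-≤ (≤-trans (dist-≢ (P-other k≢t)) (m≤m+n _ _))
        (+-mono-≤ cost-t (+-mono-≤ cost-p (+-mono-≤ cost-n z≤n))))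
      (cross-≥ P Q ((k≢t ∷ k≢p ∷ k≢n ∷ []) ∷ near!))

  -- Two steps of opposite directions yield four nonconstant windows unless they are adjacent, and
  -- then P has an isolated value between them.
  cross-mixed : ∀ P Q → Mixed P → Mixed Q → 4 ≤ cross P Q
  cross-mixed P Q P-mixed Q-mixed
    with a , Ppa , Pa ← step-exists false P (proj₂ (P-mixed false)) (proj₂ (P-mixed true))
       | c , Ppc , Pc ← step-exists true P (proj₂ (P-mixed true)) (proj₂ (P-mixed false))
    with a Fin.≟ prev c | c Fin.≟ prev a
  ... | yes refl | _ = cross-isolated P Q Ppa Pa (trans (cong P (next-prev c)) Pc) (Q-mixed true)
  ... | _ | yes refl = cross-isolated P Q Ppc Pc (trans (cong P (next-prev a)) Pa) (Q-mixed false)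
  ... | no a≢pc | no c≢pa = two-steps P Q (Ppa , Pa) (Ppc , Pc)
    ( (≢-sym (value-≢ P Ppa Pa) ∷ value-≢ P Pa Pc ∷ a≢pc ∷ [])
    ∷ (≢-sym c≢pa ∷ value-≢ P Ppa Ppc ∷ [])
    ∷ (≢-sym (value-≢ P Ppc Pc) ∷ []) ∷ [] ∷ [])

  -- With the columns exchanged, every listed point faces a window of three points of the constant
  -- column, all of the opposite value.
  cross-constant : ∀ P Q {b} → (∀ i → Q i ≡ b) → ∀ {xs} → Unique xs → All (λ i → P i ≡ not b) xs →
                   3 * length xs ≤ cross P Q
  cross-constant P Q {b} Q-const {xs} xs! xs∈P = begin
    3 * length xs                  ≡⟨ *-comm 3 (length xs) ⟩
    length xs * 3                  ≡⟨ costs xs∈P ⟨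
    List.sum (map (cost Q P) xs)   ≤⟨ cross-≥ Q P xs! ⟩
    cross Q P                      ≡⟨ cross-comm Q P ⟩
    cross P Q                      ∎
    where
    open ≤-Reasoning
    three : ∀ b → dist b (not b) + (dist b (not b) + dist b (not b)) ≡ 3
    three false = refl
    three true  = refl
    costs : ∀ {ys} → All (λ i → P i ≡ not b) ys → List.sum (map (cost Q P) ys) ≡ length ys * 3
    costs [] = refl
    costs {y ∷ ys} (Py ∷ ys∈P) rewrite Q-const y | Q-const (prev y) | Q-const (next y) | Py =
      cong₂ _+_ (three b) (costs ys∈P)

-- Double sums

sum₂ : ∀ {m n} → (Fin m → Fin n → ℕ) → ℕ
sum₂ {m} {n} f = ∑[ i < m ] ∑[ j < n ] f i j

sum₂-cong : ∀ {m n} {f g : Fin m → Fin n → ℕ} → (∀ i j → f i j ≡ g i j) → sum₂ f ≡ sum₂ g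
sum₂-cong f≡g = sum-cong-≗ λ i → sum-cong-≗ (f≡g i)

sum₂-mono : ∀ {m n} {f g : Fin m → Fin n → ℕ} → (∀ i j → f i j ≤ g i j) → sum₂ f ≤ sum₂ g
sum₂-mono f≤g = sum-mono λ i → sum-mono (f≤g i)

sum₂-distrib-+ : ∀ {m n} (f g : Fin m → Fin n → ℕ) → sum₂ (λ i j → f i j + g i j) ≡ sum₂ f + sum₂ g
sum₂-distrib-+ {m} {n} f g = trans (sum-cong-≗ {m} λ i → ∑-distrib-+ {n} (f i) (g i))
  (∑-distrib-+ {m} _ _)

sum₂-*ˡ : ∀ {m n} c (f : Fin m → Fin n → ℕ) → sum₂ (λ i j → c * f i j) ≡ c * sum₂ f
sum₂-*ˡ {m} {n} c f = sym (trans (*-distribˡ-sum {m} c _) (sum-cong-≗ λ i → *-distribˡ-sum {n} c (f i)))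

sum₂-*ʳ : ∀ {m n} c (f : Fin m → Fin n → ℕ) → sum₂ (λ i j → f i j * c) ≡ sum₂ f * c
sum₂-*ʳ c f = trans (sum₂-cong λ i j → *-comm (f i j) c) (trans (sum₂-*ˡ c f) (*-comm c _))

-- Cuts of the strong product with a cycle, numerically

-- Conjunction and disjunction are minimum and maximum, so the left side pairs the two smaller
-- values and the two larger values.
dist-sort : ∀ a b c e → dist (a ∧ b) (c ∧ e) + dist (a ∨ b) (c ∨ e) ≤ dist a e + dist b c
dist-sort false false false false = z≤n
dist-sort false false false true  = ≤-refl
dist-sort false false true  false = ≤-refl
dist-sort false false true  true  = ≤-refl
dist-sort false true  false false = ≤-refl
dist-sort false true  false true  = z≤n
dist-sort false true  true  false = z≤n
dist-sort false true  true  true  = ≤-refl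
dist-sort true  false false false = ≤-refl
dist-sort true  false false true  = z≤n
dist-sort true  false true  false = z≤n
dist-sort true  false true  true  = ≤-refl
dist-sort true  true  false false = ≤-refl
dist-sort true  true  false true  = ≤-refl
dist-sort true  true  true  false = ≤-refl
dist-sort true  true  true  true  = z≤n

module _ {m : ℕ} (A : Fin m → Fin m → ℕ) where

  -- Ordered pairs are summed, so for an adjacency matrix `A` this is twice the number of edges
  -- between `B` and its complement.
  cutWeight : (Fin m → Bool) → ℕ
  cutWeight B = sum₂ λ x y → A x y * dist (B x) (B y)

  -- Twice the number of edges leaving X in the strong product with a cycle.
  productCut : ∀ {n} → (Fin m → Fin (3 + n) → Bool) → ℕ
  productCut X = ∑[ x < m ] (2 * boundary (X x)) + sum₂ λ x y → A x y * cross (X x) (X y)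

  -- By symmetry of `A` both ends contribute equally. For `ν` the indicator of a vertex set this
  -- turns a count of edge ends in the set into a sum of degrees.
  sum-weighted : (∀ x y → A x y ≡ A y x) → (ν : Fin m → ℕ) →
    sum₂ (λ x y → A x y * (ν x + ν y)) ≡ 2 * ∑[ x < m ] (ν x * sum (A x))
  sum-weighted A-sym ν = begin
    sum₂ (λ x y → A x y * (ν x + ν y))
      ≡⟨ sum₂-cong (λ x y → distr (A x y) (ν x) (ν y)) ⟩
    sum₂ (λ x y → ν x * A x y + ν y * A x y)
      ≡⟨ sum₂-distrib-+ (λ x y → ν x * A x y) (λ x y → ν y * A x y) ⟩
    sum₂ (λ x y → ν x * A x y) + sum₂ (λ x y → ν y * A x y)
      ≡⟨ cong (sum₂ (λ x y → ν x * A x y) +_) (trans (∑-comm (λ x y → ν y * A x y))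
           (sum₂-cong λ y x → cong (ν y *_) (A-sym x y))) ⟩
    sum₂ (λ x y → ν x * A x y) + sum₂ (λ x y → ν x * A x y)
      ≡⟨ cong (λ s → s + s) (sum-cong-≗ (λ x → *-distribˡ-sum (ν x) (A x))) ⟨
    s + s
      ≡⟨ cong (s +_) (+-identityʳ s) ⟨
    2 * s ∎
    where
    open ≡-Reasoning
    s = ∑[ x < m ] (ν x * sum (A x))
    distr : ∀ a b c → a * (b + c) ≡ b * a + c * a
    distr = solve-∀

  -- Lower bounds by types of columns

  module _ {n : ℕ} (X : Fin m → Fin (3 + n) → Bool) where

    private
      N = 3 + n

    Constant : Bool → Fin m → Set
    Constant b x = ∀ i → X x i ≡ b

    constant? : ∀ b → Decidable (Constant b)
    constant? b x = Fin.all? λ i → X x i Bool.≟ b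

    nonconstant⇒mixed : ∀ {b x} → ¬ Constant b x → ¬ Constant (not b) x → Mixed (X x)
    nonconstant⇒mixed {b} {x} ¬b ¬not-b c with c Bool.≟ b
    ... | yes refl = let i , Xi = Fin.¬∀⟶∃¬ N _ (λ i → X x i Bool.≟ not c) ¬not-b in
      i , trans (Bool.¬-not Xi) (Bool.not-involutive c)
    ... | no c≢b = let i , Xi = Fin.¬∀⟶∃¬ N _ (λ i → X x i Bool.≟ b) ¬b in
      i , trans (Bool.¬-not Xi) (sym (Bool.¬-not c≢b))

    -- Regroups the cut edges between columns by layers, where edge-cuts of G become visible.
    sum-cross-swap : sum₂ (λ x y → A x y * cross (X x) (X y)) ≡
      ∑[ i < N ] sum₂ λ x y → A x y * (dist (X x i) (X y i) +
                                      (dist (X x (prev i)) (X y i) + dist (X x i) (X y (prev i))))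
    sum-cross-swap = begin
      sum₂ (λ x y → A x y * cross (X x) (X y))
        ≡⟨ sum₂-cong (λ x y → *-distribˡ-sum (A x y) (t x y)) ⟩
      ∑[ x < m ] ∑[ y < m ] ∑[ i < N ] (A x y * t x y i)
        ≡⟨ sum-cong-≗ (λ x → ∑-comm (λ y i → A x y * t x y i)) ⟩
      ∑[ x < m ] ∑[ i < N ] ∑[ y < m ] (A x y * t x y i)
        ≡⟨ ∑-comm (λ x i → ∑[ y < m ] (A x y * t x y i)) ⟩
      ∑[ i < N ] sum₂ (λ x y → A x y * t x y i) ∎
      where
      open ≡-Reasoning
      t : Fin m → Fin m → Fin N → ℕ
      t x y i = dist (X x i) (X y i) + (dist (X x (prev i)) (X y i) + dist (X x i) (X y (prev i)))

    -- Between consecutive layers P and Q the diagonal edges cost at least as much as the cuts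
    -- P ∩ Q and P ∪ Q of G together, since matching sorted pairs minimises the total distance.
    productCut-separating : ∀ ℓ → (∀ B → ∃ (λ x → B x ≡ true) → ∃ (λ x → B x ≡ false) → 2 * ℓ ≤ cutWeight B) →
      ∃ (Constant true) → ∃ (Constant false) → 2 * (3 * N * ℓ) ≤ productCut X
    productCut-separating ℓ cut-≥ (x₁ , full) (x₀ , empty) = begin
      2 * (3 * N * ℓ)
        ≡⟨ arith N ℓ ⟩
      N * (2 * ℓ + (2 * ℓ + 2 * ℓ))
        ≡⟨ sum-const N (2 * ℓ + (2 * ℓ + 2 * ℓ)) ⟨
      ∑[ i < N ] (2 * ℓ + (2 * ℓ + 2 * ℓ))
        ≤⟨ sum-mono {N} layer ⟩
      ∑[ i < N ] sum₂ (λ x y → A x y * (dist (X x i) (X y i) +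
                                      (dist (X x (prev i)) (X y i) + dist (X x i) (X y (prev i)))))
        ≡⟨ sum-cross-swap ⟨
      sum₂ (λ x y → A x y * cross (X x) (X y))
        ≤⟨ m≤n+m _ _ ⟩
      productCut X ∎
      where
      open ≤-Reasoning
      arith : ∀ N ℓ → 2 * (3 * N * ℓ) ≡ N * (2 * ℓ + (2 * ℓ + 2 * ℓ))
      arith = solve-∀
      layer : ∀ i → 2 * ℓ + (2 * ℓ + 2 * ℓ) ≤
        sum₂ (λ x y → A x y * (dist (X x i) (X y i) + (dist (X x (prev i)) (X y i) + dist (X x i) (X y (prev i)))))
      layer i = begin
        2 * ℓ + (2 * ℓ + 2 * ℓ)
          -- The full column lies in each of the three sets and the empty column in none, so all
          -- three define edge-cuts of G.
          ≤⟨ +-mono-≤ (cut-≥ B₁ (x₁ , full i) (x₀ , empty i))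
               (+-mono-≤ (cut-≥ B₂ (x₁ , cong₂ _∧_ (full (prev i)) (full i)) (x₀ , cong₂ _∧_ (empty (prev i)) (empty i)))
                         (cut-≥ B₃ (x₁ , cong₂ _∨_ (full (prev i)) (full i)) (x₀ , cong₂ _∨_ (empty (prev i)) (empty i)))) ⟩
        cutWeight B₁ + (cutWeight B₂ + cutWeight B₃)
          ≡⟨ cong (cutWeight B₁ +_) (sum₂-distrib-+ (w B₂) (w B₃)) ⟨
        cutWeight B₁ + sum₂ (λ x y → A x y * dist (B₂ x) (B₂ y) + A x y * dist (B₃ x) (B₃ y))
          ≡⟨ sum₂-distrib-+ (w B₁) _ ⟨
        sum₂ (λ x y → A x y * dist (B₁ x) (B₁ y) + (A x y * dist (B₂ x) (B₂ y) + A x y * dist (B₃ x) (B₃ y)))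
          ≡⟨ sum₂-cong (λ x y → factor (A x y) (dist (B₁ x) (B₁ y)) _ _) ⟩
        sum₂ (λ x y → A x y * (dist (B₁ x) (B₁ y) + (dist (B₂ x) (B₂ y) + dist (B₃ x) (B₃ y))))
          ≤⟨ sum₂-mono (λ x y → *-monoʳ-≤ (A x y) (+-monoʳ-≤ (dist (B₁ x) (B₁ y))
               (dist-sort (X x (prev i)) (X x i) (X y (prev i)) (X y i)))) ⟩
        sum₂ (λ x y → A x y * (dist (X x i) (X y i) + (dist (X x (prev i)) (X y i) + dist (X x i) (X y (prev i))))) ∎
        where
        B₁ B₂ B₃ : Fin m → Bool
        B₁ x = X x i
        B₂ x = X x (prev i) ∧ X x i
        B₃ x = X x (prev i) ∨ X x i
        w : (Fin m → Bool) → Fin m → Fin m → ℕ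
        w B x y = A x y * dist (B x) (B y)
        factor : ∀ a b c e → a * b + (a * c + a * e) ≡ a * (b + (c + e))
        factor = solve-∀

    productCut-mixed : (∀ x → Mixed (X x)) → 4 * m + 4 * sum₂ A ≤ productCut X
    productCut-mixed mixed = begin
      4 * m + 4 * sum₂ A
        ≡⟨ cong₂ _+_ (trans (*-comm 4 m) (sym (sum-const m 4))) (trans (*-comm 4 (sum₂ A)) (sym (sum₂-*ʳ 4 A))) ⟩
      ∑[ x < m ] 4 + sum₂ (λ x y → A x y * 4)
        ≤⟨ +-mono-≤ (sum-mono λ x → *-monoʳ-≤ 2 (boundary-mixed (X x) (mixed x)))
             (sum₂-mono λ x y → *-monoʳ-≤ (A x y) (cross-mixed (X x) (X y) (mixed x) (mixed y))) ⟩
      productCut X ∎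
      where open ≤-Reasoning

    module _ (A-sym : ∀ x y → A x y ≡ A y x) (A-irrefl : ∀ x → A x x ≡ 0) (A≤1 : ∀ x y → A x y ≤ 1)
             {d : ℕ} (d≤deg : ∀ x → d ≤ sum (A x)) where

      module _ {b : Bool} where

        cross-mixed-≥3 : ∀ {x y} → Mixed (X x) → Constant b y ⊎ Mixed (X y) → 3 ≤ cross (X x) (X y)
        cross-mixed-≥3 {x} {y} mixed (inj₁ const) =
          cross-constant (X x) (X y) const ([] ∷ []) (proj₂ (mixed (not b)) ∷ [])
        cross-mixed-≥3 {x} {y} mixed (inj₂ mixed′) = ≤-trans (n≤1+n 3) (cross-mixed (X x) (X y) mixed mixed′)

        -- Counting 3 for every edge end in {x₀, x₁} exceeds the true bound only at the edge x₀x₁, which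
        -- gives 4 rather than 6; the second boundary makes up for that.
        productCut-two-columns : (∀ x → Constant b x ⊎ Mixed (X x)) →
          ∀ {x₀ x₁} → x₀ ≢ x₁ → Mixed (X x₀) → Mixed (X x₁) → 2 * (6 * d + 2) ≤ productCut X
        productCut-two-columns columns {x₀} {x₁} x₀≢x₁ mixed₀ mixed₁ = +-cancelʳ-≤ 4 _ _ (begin
          -- The added 4 pays for the surplus: 2 for each of the two orientations of a possible edge
          -- x₀x₁.
          2 * (6 * d + 2) + 4
            ≡⟨ arith d ⟩
          8 + 3 * (2 * (d + d))
            ≤⟨ +-mono-≤ boundaries (*-monoʳ-≤ 3 (*-monoʳ-≤ 2 (+-mono-≤ (d≤deg x₀) (d≤deg x₁)))) ⟩
          bs + 3 * (2 * (sum (A x₀) + sum (A x₁)))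
            ≡⟨ cong (λ s → bs + 3 * (2 * s)) (sum-ν (λ x → sum (A x))) ⟨
          bs + 3 * (2 * ∑[ x < m ] (ν x * sum (A x)))
            ≡⟨ cong (λ s → bs + 3 * s) (sum-weighted A-sym ν) ⟨
          bs + 3 * sum₂ (λ x y → A x y * (ν x + ν y))
            ≡⟨ cong (bs +_) (sum₂-*ˡ 3 (λ x y → A x y * (ν x + ν y))) ⟨
          bs + sum₂ (λ x y → 3 * (A x y * (ν x + ν y)))
            ≤⟨ +-monoʳ-≤ bs (sum₂-mono λ x y → pointwise (A x y) (edge x y (ν-cases x) (ν-cases y))) ⟩
          bs + sum₂ (λ x y → A x y * cross (X x) (X y) + 2 * (A x y * (ν x * ν y)))
            ≡⟨ cong (bs +_) (sum₂-distrib-+ (λ x y → A x y * cross (X x) (X y)) (λ x y → 2 * (A x y * (ν x * ν y)))) ⟩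
          bs + (cs + sum₂ (λ x y → 2 * (A x y * (ν x * ν y))))
            ≡⟨ cong (λ s → bs + (cs + s)) (sum₂-*ˡ 2 (λ x y → A x y * (ν x * ν y))) ⟩
          bs + (cs + 2 * sum₂ (λ x y → A x y * (ν x * ν y)))
            ≤⟨ +-monoʳ-≤ bs (+-monoʳ-≤ cs (*-monoʳ-≤ 2 inner)) ⟩
          bs + (cs + 4)
            ≡⟨ +-assoc bs cs 4 ⟨
          productCut X + 4 ∎)
          where
          open ≤-Reasoning
          bs = ∑[ x < m ] (2 * boundary (X x))
          cs = sum₂ λ x y → A x y * cross (X x) (X y)
          ν : Fin m → ℕ
          ν x = ind (does (x Fin.≟ x₀)) + ind (does (x Fin.≟ x₁))
          arith : ∀ d → 2 * (6 * d + 2) + 4 ≡ 8 + 3 * (2 * (d + d))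
          arith = solve-∀
          boundaries : 8 ≤ bs
          boundaries = ≤-trans
            (+-mono-≤ (*-monoʳ-≤ 2 (boundary-mixed (X x₀) mixed₀)) (+-mono-≤ (*-monoʳ-≤ 2 (boundary-mixed (X x₁) mixed₁)) z≤n))
            (sum-unique-≤ (λ x → 2 * boundary (X x)) ((x₀≢x₁ ∷ []) ∷ [] ∷ []))
          sum-ν : ∀ f → ∑[ x < m ] (ν x * f x) ≡ f x₀ + f x₁
          sum-ν f = trans (sum-cong-≗ λ x → *-distribʳ-+ (f x) (ind (does (x Fin.≟ x₀))) _)
            (trans (∑-distrib-+ {m} _ _)
              (cong₂ _+_ (sum-select (Fin._≟ x₀) f x₀ refl id) (sum-select (Fin._≟ x₁) f x₁ refl id)))
          ν-cases : ∀ x → ν x ≡ 0 ⊎ (ν x ≡ 1 × Mixed (X x))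
          ν-cases x with x Fin.≟ x₀ | x Fin.≟ x₁
          ... | yes refl | yes refl = contradiction refl x₀≢x₁
          ... | yes refl | no _     = inj₂ (refl , mixed₀)
          ... | no _     | yes refl = inj₂ (refl , mixed₁)
          ... | no _     | no _     = inj₁ refl
          edge : ∀ x y → ν x ≡ 0 ⊎ (ν x ≡ 1 × Mixed (X x)) → ν y ≡ 0 ⊎ (ν y ≡ 1 × Mixed (X y)) →
                 3 * (ν x + ν y) ≤ cross (X x) (X y) + 2 * (ν x * ν y)
          edge x y (inj₁ νx) (inj₁ νy) rewrite νx | νy = z≤n
          edge x y (inj₁ νx) (inj₂ (νy , y-mixed)) rewrite νx | νy = ≤-trans
            (≤-trans (cross-mixed-≥3 y-mixed (columns x)) (≤-reflexive (cross-comm (X y) (X x)))) (m≤m+n _ _)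
          edge x y (inj₂ (νx , x-mixed)) (inj₁ νy) rewrite νx | νy =
            ≤-trans (cross-mixed-≥3 x-mixed (columns y)) (m≤m+n _ _)
          edge x y (inj₂ (νx , x-mixed)) (inj₂ (νy , y-mixed)) rewrite νx | νy =
            +-monoˡ-≤ 2 (cross-mixed (X x) (X y) x-mixed y-mixed)
          pointwise : ∀ a {s c p} → 3 * s ≤ c + 2 * p → 3 * (a * s) ≤ a * c + 2 * (a * p)
          pointwise a {s} {c} {p} 3s≤c+2p = begin
            3 * (a * s)          ≡⟨ assocˡ a s ⟩
            a * (3 * s)          ≤⟨ *-monoʳ-≤ a 3s≤c+2p ⟩
            a * (c + 2 * p)      ≡⟨ distr a c p ⟩
            a * c + 2 * (a * p)  ∎
            where
            assocˡ : ∀ a s → 3 * (a * s) ≡ a * (3 * s)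
            assocˡ = solve-∀
            distr : ∀ a c p → a * (c + 2 * p) ≡ a * c + 2 * (a * p)
            distr = solve-∀
          inner : sum₂ (λ x y → A x y * (ν x * ν y)) ≤ 2
          inner = begin
            sum₂ (λ x y → A x y * (ν x * ν y))
              ≡⟨ sum₂-cong (λ x y → reorder (A x y) (ν x) (ν y)) ⟩
            sum₂ (λ x y → ν x * (ν y * A x y))
              ≡⟨ sum-cong-≗ (λ x → *-distribˡ-sum (ν x) (λ y → ν y * A x y)) ⟨
            ∑[ x < m ] (ν x * ∑[ y < m ] (ν y * A x y))
              ≡⟨ sum-cong-≗ (λ x → cong (ν x *_) (sum-ν (A x))) ⟩
            ∑[ x < m ] (ν x * (A x x₀ + A x x₁))
              ≡⟨ sum-ν (λ x → A x x₀ + A x x₁) ⟩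
            (A x₀ x₀ + A x₀ x₁) + (A x₁ x₀ + A x₁ x₁)
              ≤⟨ +-mono-≤ (+-mono-≤ (≤-reflexive (A-irrefl x₀)) (A≤1 x₀ x₁))
                          (+-mono-≤ (A≤1 x₁ x₀) (≤-reflexive (A-irrefl x₁))) ⟩
            2 ∎
            where
            reorder : ∀ a u v → a * (u * v) ≡ u * (v * a)
            reorder = solve-∀

        -- The points `i` and `j` of column `x₀` each face three points of value `b` in every
        -- adjacent column. This makes 6 cut edges for each edge of G at `x₀`, besides the boundary
        -- inside the column.
        productCut-one-column : ∀ {x₀ i j} → Mixed (X x₀) → (∀ x → x ≢ x₀ → Constant b x) →
          i ≢ j → X x₀ i ≡ not b → X x₀ j ≡ not b → 2 * (6 * d + 2) ≤ productCut X
        productCut-one-column {x₀} {i} {j} mixed const i≢j Xi Xj = begin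
          2 * (6 * d + 2)
            ≡⟨ arith d ⟩
          4 + 6 * (2 * d)
            ≤⟨ +-mono-≤ boundaries (*-monoʳ-≤ 6 (*-monoʳ-≤ 2 (d≤deg x₀))) ⟩
          bs + 6 * (2 * sum (A x₀))
            ≡⟨ cong (λ s → bs + 6 * (2 * s)) (sum-select (Fin._≟ x₀) (λ x → sum (A x)) x₀ refl id) ⟨
          bs + 6 * (2 * ∑[ x < m ] (ν x * sum (A x)))
            ≡⟨ cong (λ s → bs + 6 * s) (sum-weighted A-sym ν) ⟨
          bs + 6 * sum₂ (λ x y → A x y * (ν x + ν y))
            ≡⟨ cong (bs +_) (sum₂-*ˡ 6 (λ x y → A x y * (ν x + ν y))) ⟨
          bs + sum₂ (λ x y → 6 * (A x y * (ν x + ν y)))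
            ≤⟨ +-monoʳ-≤ bs (sum₂-mono edge) ⟩
          productCut X ∎
          where
          open ≤-Reasoning
          bs = ∑[ x < m ] (2 * boundary (X x))
          ν : Fin m → ℕ
          ν x = ind (does (x Fin.≟ x₀))
          arith : ∀ d → 2 * (6 * d + 2) ≡ 4 + 6 * (2 * d)
          arith = solve-∀
          boundaries : 4 ≤ bs
          boundaries = ≤-trans (+-mono-≤ (*-monoʳ-≤ 2 (boundary-mixed (X x₀) mixed)) z≤n)
            (sum-unique-≤ (λ x → 2 * boundary (X x)) ([] ∷ []))
          cross-≥6 : ∀ {y} → y ≢ x₀ → 6 ≤ cross (X x₀) (X y)
          cross-≥6 {y} y≢x₀ =
            cross-constant (X x₀) (X y) (const y y≢x₀) ((i≢j ∷ []) ∷ [] ∷ []) (Xi ∷ Xj ∷ [])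
          edge : ∀ x y → 6 * (A x y * (ν x + ν y)) ≤ A x y * cross (X x) (X y)
          edge x y with x Fin.≟ x₀ | y Fin.≟ x₀
          ... | yes refl | yes refl rewrite A-irrefl x = z≤n
          ... | yes refl | no y≢x₀ rewrite *-identityʳ (A x y) | *-comm 6 (A x y) =
            *-monoʳ-≤ (A x y) (cross-≥6 y≢x₀)
          ... | no x≢x₀ | yes refl rewrite *-identityʳ (A x y) | *-comm 6 (A x y) =
            *-monoʳ-≤ (A x y) (≤-trans (cross-≥6 x≢x₀) (≤-reflexive (cross-comm (X y) (X x))))
          ... | no _ | no _ rewrite *-zeroʳ (A x y) = z≤n

      -- The column of the first given point is mixed. Either a second column is mixed too, or all
      -- others have the constant value `b` and both given points lie in the same column.
      productCut-no-constant : ∀ b → ¬ ∃ (Constant (not b)) →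
        AtLeastTwo {Fin m × Fin N} (λ (x , i) → X x i ≡ not b) → 2 * (6 * d + 2) ≤ productCut X
      productCut-no-constant b none ((x , i) , (y , j) , xi≢yj , Xxi , Xyj)
        with Fin.any? (λ z → ¬? (z Fin.≟ x) ×-dec ¬? (constant? b z))
      ... | yes (z , z≢x , ¬const) = productCut-two-columns columns z≢x
              (nonconstant⇒mixed ¬const λ c → none (z , c))
              (nonconstant⇒mixed (λ c → Bool.not-¬ (c i) Xxi) λ c → none (x , c))
        where
        columns : ∀ x → Constant b x ⊎ Mixed (X x)
        columns x with constant? b x
        ... | yes const = inj₁ const
        ... | no ¬const = inj₂ (nonconstant⇒mixed ¬const λ c → none (x , c))
      ... | no ¬other with y Fin.≟ x
      ... | no y≢x   = contradiction (y , y≢x , λ c → Bool.not-¬ (c j) Xyj) ¬other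
      ... | yes refl = productCut-one-column
              (nonconstant⇒mixed (λ c → Bool.not-¬ (c i) Xxi) λ c → none (x , c)) constant (λ { refl → xi≢yj refl }) Xxi Xyj
        where
        constant : ∀ z → z ≢ x → Constant b z
        constant z z≢x with constant? b z
        ... | yes const = const
        ... | no ¬const = contradiction (z , z≢x , ¬const) ¬other

      productCut-≥ : ∀ ℓ →
        (∀ B → ∃ (λ x → B x ≡ true) → ∃ (λ x → B x ≡ false) → 2 * ℓ ≤ cutWeight B) →
        (∀ b → AtLeastTwo {Fin m × Fin N} (λ (x , i) → X x i ≡ b)) →
        2 * (3 * N * ℓ) ≤ productCut X ⊎ 4 * m + 4 * sum₂ A ≤ productCut X ⊎ 2 * (6 * d + 2) ≤ productCut X
      productCut-≥ ℓ cut-≥ two with Fin.any? (constant? true) | Fin.any? (constant? false)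
      ... | yes full | yes empty = inj₁ (productCut-separating ℓ cut-≥ full empty)
      ... | no ¬full | no ¬empty = inj₂ (inj₁ (productCut-mixed λ x →
              nonconstant⇒mixed (λ c → ¬full (x , c)) λ c → ¬empty (x , c)))
      ... | yes _    | no ¬empty = inj₂ (inj₂ (productCut-no-constant true ¬empty (two false)))
      ... | no ¬full | yes _     = inj₂ (inj₂ (productCut-no-constant false ¬full (two true)))

-- Edge sets and cuts of graphs

index : (G : Graph) → Vertex G → Fin (order G)
index G = Inverse.from (enumeration G)

vertex-index : (G : Graph) (u : Vertex G) → vertex G (index G u) ≡ u
vertex-index G = Inverse.strictlyInverseˡ (enumeration G)

index-vertex : (G : Graph) (i : Fin (order G)) → index G (vertex G i) ≡ i
index-vertex G = Inverse.strictlyInverseʳ (enumeration G)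

vertex-injective : (G : Graph) {i j : Fin (order G)} → vertex G i ≡ vertex G j → i ≡ j
vertex-injective G {i} {j} eq = trans (sym (index-vertex G i)) (trans (cong (index G) eq) (index-vertex G j))

-- Doubling replaces the condition `i < j` by a sum over all ordered pairs, which splits well over
-- products; for this reason all cuts are counted twice throughout.
card-double : ∀ {G} (S : EdgeSet G) →
  2 * ∣ S ∣ ≡ sum₂ λ i j → ind (does (member? S (vertex G i) (vertex G j)))
card-double {G} S = begin
  2 * ∣ S ∣
    ≡⟨ cong (2 *_) (length-filter-cartesianProduct
         (λ (i , j) → i Fin.<? j ×-dec member? S (vertex G i) (vertex G j)) id id) ⟩
  2 * sum₂ (λ i j → ind (does (i Fin.<? j) ∧ does (member? S (vertex G i) (vertex G j))))
    ≡⟨ cong (2 *_) (sum₂-cong λ i j → ind-∧ (does (i Fin.<? j)) (does (member? S (vertex G i) (vertex G j)))) ⟩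
  2 * sum₂ (λ i j → ind (does (i Fin.<? j)) * r i j)
    ≡⟨ sum-symmetric r
         (λ i j → cong ind (does-⇔ (mk⇔ (member-sym S) (member-sym S)) (member? S _ _) (member? S _ _)))
         (λ i → cong ind (dec-false (member? S _ _) (~-irrefl G refl ∘ member⇒~ S))) ⟩
  sum₂ r ∎
  where
  open ≡-Reasoning
  r : Fin (order G) → Fin (order G) → ℕ
  r i j = ind (does (member? S (vertex G i) (vertex G j)))

adj : (G : Graph) → Vertex G → Vertex G → ℕ
adj G u v = ind (does (_~?_ G u v))

-- The common form of the boundary of a vertex set and of the lift of an edge set to the product.
edgesWhere : (G : Graph) {R : Vertex G → Vertex G → Set} → Decidable₂ R → Symmetric R → EdgeSet G
edgesWhere G {R} R? R-sym = record
  { Member     = λ u v → _~_ G u v × R u v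
  ; member?    = λ u v → _~?_ G u v ×-dec R? u v
  ; member-sym = λ (u~v , Ruv) → ~-sym G u~v , R-sym Ruv
  ; member⇒~   = proj₁
  }

card-edgesWhere : (G : Graph) {R : Vertex G → Vertex G → Set} (R? : Decidable₂ R) (R-sym : Symmetric R) →
  2 * ∣ edgesWhere G R? R-sym ∣ ≡
  sum₂ λ i j → adj G (vertex G i) (vertex G j) * ind (does (R? (vertex G i) (vertex G j)))
card-edgesWhere G R? R-sym = trans (card-double (edgesWhere G R? R-sym))
  (sum₂-cong λ i j → ind-∧ (does (_~?_ G (vertex G i) (vertex G j))) (does (R? (vertex G i) (vertex G j))))

-- Edge sums over a strong product

adj-⊠ : (G H : Graph) (x y : Vertex G) (i j : Vertex H) →
  adj (G ⊠ H) (x , i) (y , j) ≡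
  ind (does (_≟_ G x y)) * adj H i j + adj G x y * (ind (does (_≟_ H i j)) + adj H i j)
adj-⊠ G H x y i j = lemma (_≟_ G x y) (_≟_ H i j) (_~?_ G x y) (_~?_ H i j)
  where
  lemma : (x≟y : Dec (x ≡ y)) (i≟j : Dec (i ≡ j)) (x~?y : Dec (_~_ G x y)) (i~?j : Dec (_~_ H i j)) →
    ind (does x≟y ∧ does i~?j ∨ (does i≟j ∧ does x~?y ∨ does x~?y ∧ does i~?j)) ≡
    ind (does x≟y) * ind (does i~?j) + ind (does x~?y) * (ind (does i≟j) + ind (does i~?j))
  -- The three kinds of adjacency exclude one another, because equality in a factor rules out
  -- adjacency there; hence the indicator of the disjunction is a sum.
  lemma (yes x≡y) _         (yes x~y) _         = contradiction x~y (~-irrefl G x≡y)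
  lemma _         (yes i≡j) _         (yes i~j) = contradiction i~j (~-irrefl H i≡j)
  lemma (yes _)   _         (no _)    (yes _)   = refl
  lemma (yes _)   (yes _)   (no _)    (no _)    = refl
  lemma (yes _)   (no _)    (no _)    (no _)    = refl
  lemma (no _)    (yes _)   (yes _)   (no _)    = refl
  lemma (no _)    (yes _)   (no _)    (no _)    = refl
  lemma (no _)    (no _)    (yes _)   (yes _)   = refl
  lemma (no _)    (no _)    (yes _)   (no _)    = refl
  lemma (no _)    (no _)    (no _)    (yes _)   = refl
  lemma (no _)    (no _)    (no _)    (no _)    = refl

sum-≟ : (G : Graph) (f : Fin (order G) → ℕ) (i : Fin (order G)) →
        ∑[ j < order G ] (ind (does (_≟_ G (vertex G i) (vertex G j))) * f j) ≡ f i
sum-≟ G f i = sum-select (λ j → _≟_ G (vertex G i) (vertex G j)) f i refl (sym ∘ vertex-injective G)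

-- Splits the edges, weighted by `h`, into those inside a column and those over an edge of G, the
-- latter being level or diagonal.
sum-⊠ : (G H : Graph) (h : Vertex (G ⊠ H) → Vertex (G ⊠ H) → ℕ) →
  let x̂ = vertex G; î = vertex H in
  sum₂ (λ k l → adj (G ⊠ H) (vertex (G ⊠ H) k) (vertex (G ⊠ H) l) * h (vertex (G ⊠ H) k) (vertex (G ⊠ H) l)) ≡
  ∑[ x < order G ] sum₂ (λ i j → adj H (î i) (î j) * h (x̂ x , î i) (x̂ x , î j)) +
  sum₂ λ x y → adj G (x̂ x) (x̂ y) *
    (∑[ i < order H ] h (x̂ x , î i) (x̂ y , î i) + sum₂ (λ i j → adj H (î i) (î j) * h (x̂ x , î i) (x̂ y , î j)))
sum-⊠ G H h = begin
  sum₂ (λ k l → adj (G ⊠ H) (vertex (G ⊠ H) k) (vertex (G ⊠ H) l) * h (vertex (G ⊠ H) k) (vertex (G ⊠ H) l))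
    ≡⟨ sum-cong-≗ (λ k → sum-* m n (λ q → F (remQuot n k) q)) ⟩
  ∑[ k < m * n ] sum₂ (λ y j → F (remQuot n k) (y , j))
    ≡⟨ sum-* m n (λ p → sum₂ λ y j → F p (y , j)) ⟩
  sum₂ (λ x i → sum₂ λ y j → F (x , i) (y , j))
    ≡⟨ sum₂-cong row ⟩
  sum₂ (λ x i → ∑[ j < n ] (aH i j * f x i x j) + ∑[ y < m ] (aG x y * t x y i))
    ≡⟨ sum₂-distrib-+ (λ x i → ∑[ j < n ] (aH i j * f x i x j)) (λ x i → ∑[ y < m ] (aG x y * t x y i)) ⟩
  first + sum₂ (λ x i → ∑[ y < m ] (aG x y * t x y i))
    ≡⟨ cong (first +_) (sum-cong-≗ λ x → trans (∑-comm (λ i y → aG x y * t x y i))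
         (sum-cong-≗ λ y → sym (*-distribˡ-sum (aG x y) (t x y)))) ⟩
  first + sum₂ (λ x y → aG x y * ∑[ i < n ] t x y i)
    ≡⟨ cong (first +_) (sum₂-cong λ x y → cong (aG x y *_)
         (∑-distrib-+ (λ i → f x i y i) (λ i → ∑[ j < n ] (aH i j * f x i y j)))) ⟩
  first + sum₂ (λ x y → aG x y * (∑[ i < n ] f x i y i + sum₂ (λ i j → aH i j * f x i y j))) ∎
  where
  open ≡-Reasoning
  m = order G
  n = order H
  aG : Fin m → Fin m → ℕ
  aG x y = adj G (vertex G x) (vertex G y)
  aH : Fin n → Fin n → ℕ
  aH i j = adj H (vertex H i) (vertex H j)
  f : Fin m → Fin n → Fin m → Fin n → ℕ
  f x i y j = h (vertex G x , vertex H i) (vertex G y , vertex H j)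
  F : Fin m × Fin n → Fin m × Fin n → ℕ
  F (x , i) (y , j) = adj (G ⊠ H) (vertex G x , vertex H i) (vertex G y , vertex H j) * f x i y j
  t : Fin m → Fin m → Fin n → ℕ
  t x y i = f x i y i + ∑[ j < n ] (aH i j * f x i y j)
  first = ∑[ x < m ] sum₂ (λ i j → aH i j * f x i x j)
  eqG : Fin m → Fin m → ℕ
  eqG x y = ind (does (_≟_ G (vertex G x) (vertex G y)))
  eqH : Fin n → Fin n → ℕ
  eqH i j = ind (does (_≟_ H (vertex H i) (vertex H j)))
  expand : ∀ p q r s v → (p * q + r * (s + q)) * v ≡ p * (q * v) + r * (s * v + q * v)
  expand = solve-∀
  row : ∀ x i → sum₂ (λ y j → F (x , i) (y , j)) ≡
                ∑[ j < n ] (aH i j * f x i x j) + ∑[ y < m ] (aG x y * t x y i)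
  row x i = begin
    sum₂ (λ y j → F (x , i) (y , j))
      ≡⟨ sum₂-cong (λ y j → trans (cong (_* f x i y j) (adj-⊠ G H (vertex G x) (vertex G y) (vertex H i) (vertex H j)))
           (expand (eqG x y) (aH i j) (aG x y) (eqH i j) (f x i y j))) ⟩
    sum₂ (λ y j → eqG x y * (aH i j * f x i y j) + aG x y * (eqH i j * f x i y j + aH i j * f x i y j))
      ≡⟨ sum₂-distrib-+ (λ y j → eqG x y * (aH i j * f x i y j))
           (λ y j → aG x y * (eqH i j * f x i y j + aH i j * f x i y j)) ⟩
    sum₂ (λ y j → eqG x y * (aH i j * f x i y j)) +
    sum₂ (λ y j → aG x y * (eqH i j * f x i y j + aH i j * f x i y j))
      ≡⟨ cong₂ _+_
           (trans (sum-cong-≗ λ y → sym (*-distribˡ-sum (eqG x y) (λ j → aH i j * f x i y j)))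
                  (sum-≟ G (λ y → ∑[ j < n ] (aH i j * f x i y j)) x))
           (sum-cong-≗ λ y → trans (sym (*-distribˡ-sum (aG x y) (λ j → eqH i j * f x i y j + aH i j * f x i y j)))
             (cong (aG x y *_) (trans (∑-distrib-+ (λ j → eqH i j * f x i y j) (λ j → aH i j * f x i y j))
               (cong (_+ ∑[ j < n ] (aH i j * f x i y j)) (sum-≟ H (f x i y) i))))) ⟩
    ∑[ j < n ] (aH i j * f x i x j) + ∑[ y < m ] (aG x y * t x y i) ∎

-- Edge sums over a cycle and over its product with a graph

Next⇒prev : ∀ {n} {i j : Fin (suc n)} → Next i j → i ≡ prev j
Next⇒prev {j = zero}  (inj₂ (1+i≡n , _)) = Fin.toℕ-injective (trans (suc-injective 1+i≡n) (sym (Fin.toℕ-fromℕ _)))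
Next⇒prev {j = suc j} (inj₁ 1+i≡j) = Fin.toℕ-injective (trans (suc-injective 1+i≡j) (sym (Fin.toℕ-inject₁ j)))

prev-Next : ∀ {n} (j : Fin (suc n)) → Next (prev j) j
prev-Next {n} zero = inj₂ (cong suc (Fin.toℕ-fromℕ n) , refl)
prev-Next (suc j)  = inj₁ (cong suc (Fin.toℕ-inject₁ j))

-- The indicator of adjacency is the sum of the indicators of the two directions, since both at once
-- would give `prev (prev j) ≡ j`; each direction then selects a single index.
sum-cycle : ∀ {n} (3≤N : 3 ≤ 3 + n) (f : Fin (3 + n) → Fin (3 + n) → ℕ) →
  sum₂ (λ i j → adj (cycle (3 + n) 3≤N) i j * f i j) ≡ ∑[ i < 3 + n ] (f (prev i) i + f i (prev i))
sum-cycle {n} 3≤N f = begin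
  sum₂ (λ i j → adj (cycle N 3≤N) i j * f i j)
    ≡⟨ sum₂-cong split ⟩
  sum₂ (λ i j → ind (does (next? i j)) * f i j + ind (does (next? j i)) * f i j)
    ≡⟨ sum₂-distrib-+ (λ i j → ind (does (next? i j)) * f i j) (λ i j → ind (does (next? j i)) * f i j) ⟩
  sum₂ (λ i j → ind (does (next? i j)) * f i j) + sum₂ (λ i j → ind (does (next? j i)) * f i j)
    ≡⟨ cong₂ _+_
         (trans (∑-comm (λ i j → ind (does (next? i j)) * f i j))
                (sum-cong-≗ λ j → sum-select (λ i → next? i j) (λ i → f i j) (prev j) (prev-Next j) Next⇒prev))
         (sum-cong-≗ λ i → sum-select (λ j → next? j i) (f i) (prev i) (prev-Next i) Next⇒prev) ⟩
  ∑[ i < N ] f (prev i) i + ∑[ i < N ] f i (prev i)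
    ≡⟨ ∑-distrib-+ (λ i → f (prev i) i) (λ i → f i (prev i)) ⟨
  ∑[ i < N ] (f (prev i) i + f i (prev i)) ∎
  where
  open ≡-Reasoning
  N = 3 + n
  split : ∀ i j → adj (cycle N 3≤N) i j * f i j ≡ ind (does (next? i j)) * f i j + ind (does (next? j i)) * f i j
  split i j = lemma (next? i j) (next? j i)
    where
    lemma : (i→j : Dec (Next i j)) (j→i : Dec (Next j i)) →
      ind (does i→j ∨ does j→i) * f i j ≡ ind (does i→j) * f i j + ind (does j→i) * f i j
    lemma (yes p) (yes q) = contradiction (sym (trans (Next⇒prev q) (cong prev (Next⇒prev p)))) (prev²≢id j)
    lemma (yes _) (no _)  = sym (+-identityʳ _)
    lemma (no _)  (yes _) = refl
    lemma (no _)  (no _)  = refl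

sum-⊠-cycle : (G : Graph) {n : ℕ} (3≤N : 3 ≤ 3 + n) →
  let H = G ⊠ cycle (3 + n) 3≤N; x̂ = vertex G in (h : Vertex H → Vertex H → ℕ) →
  sum₂ (λ k l → adj H (vertex H k) (vertex H l) * h (vertex H k) (vertex H l)) ≡
  ∑[ x < order G ] ∑[ i < 3 + n ] (h (x̂ x , prev i) (x̂ x , i) + h (x̂ x , i) (x̂ x , prev i)) +
  sum₂ λ x y → adj G (x̂ x) (x̂ y) *
    ∑[ i < 3 + n ] (h (x̂ x , i) (x̂ y , i) + (h (x̂ x , prev i) (x̂ y , i) + h (x̂ x , i) (x̂ y , prev i)))
sum-⊠-cycle G {n} 3≤N h = trans (sum-⊠ G C h) (cong₂ _+_
  (sum-cong-≗ λ x → sum-cycle 3≤N λ i j → h (x̂ x , i) (x̂ x , j))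
  (sum₂-cong λ x y → cong (adj G (x̂ x) (x̂ y) *_) (trans
    (cong (∑[ i < N ] h (x̂ x , i) (x̂ y , i) +_) (sum-cycle 3≤N λ i j → h (x̂ x , i) (x̂ y , j)))
    (sym (∑-distrib-+ (λ i → h (x̂ x , i) (x̂ y , i))
                      (λ i → h (x̂ x , prev i) (x̂ y , i) + h (x̂ x , i) (x̂ y , prev i)))))))
  where
  N = 3 + n
  C = cycle N 3≤N
  x̂ = vertex G

adjᵥ : (G : Graph) → Fin (order G) → Fin (order G) → ℕ
adjᵥ G x y = adj G (vertex G x) (vertex G y)

∂ : (G : Graph) → (Vertex G → Bool) → EdgeSet G
∂ G X = edgesWhere G (λ u v → ¬? (X u Bool.≟ X v)) ≢-sym

cut-⊠-cycle : (G : Graph) {n : ℕ} (3≤N : 3 ≤ 3 + n) → let H = G ⊠ cycle (3 + n) 3≤N in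
  (X : Vertex H → Bool) →
  sum₂ (λ k l → adj H (vertex H k) (vertex H l) * dist (X (vertex H k)) (X (vertex H l))) ≡
  productCut (adjᵥ G) (λ x i → X (vertex G x , i))
cut-⊠-cycle G {n} 3≤N X = trans (sum-⊠-cycle G 3≤N λ u v → dist (X u) (X v))
  (cong (_+ sum₂ λ x y → adjᵥ G x y * cross (λ i → X (vertex G x , i)) (λ i → X (vertex G y , i)))
    (sum-cong-≗ λ x → double λ i → X (vertex G x , i)))
  where
  double : (P : Fin (3 + n) → Bool) →
    ∑[ i < 3 + n ] (dist (P (prev i)) (P i) + dist (P i) (P (prev i))) ≡ 2 * boundary P
  double P = trans (∑-distrib-+ (λ i → dist (P (prev i)) (P i)) (λ i → dist (P i) (P (prev i))))
    (cong (boundary P +_) (trans (sum-cong-≗ λ i → dist-comm (P i) (P (prev i))) (sym (+-identityʳ (boundary P)))))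

-- Degrees, boundaries and sides of cuts

degree-sum : (G : Graph) (u : Vertex G) → degree G u ≡ ∑[ j < order G ] adj G u (vertex G j)
degree-sum G u = trans (cong (length ∘ filter (_~?_ G u)) (map-tabulate id (vertex G)))
  (length-filter-tabulate (_~?_ G u) (vertex G))

δ≤degree : (G : Graph) (i : Fin (order G)) → δ G ≤ degree G (vertex G i)
δ≤degree G = All.tabulate⁻ ∘ All.map⁻ ∘ All.map⁻ $ min≤xs (order G) (map (degree G) (vertices G))

δ-attained : (G : Graph) → Vertex G → ∃ λ u → degree G u ≤ δ G
δ-attained G u with argmin-sel id (order G) (map (degree G) (vertices G))
-- If the minimum is the default `order G`, any vertex will do, since no degree exceeds the number
-- of vertices.
... | inj₁ δ≡order = u , ≤-trans (length-filter (_~?_ G u) (vertices G)) (≤-reflexive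
        (trans (length-map (vertex G) (allFin (order G))) (trans (length-tabulate id) (sym δ≡order))))
... | inj₂ δ∈degrees with v , _ , δ≡degree ← ∈-map⁻ (degree G) δ∈degrees = v , ≤-reflexive (sym δ≡degree)

adjᵥ-sym : (G : Graph) → ∀ x y → adjᵥ G x y ≡ adjᵥ G y x
adjᵥ-sym G x y = cong ind (does-⇔ (mk⇔ (~-sym G) (~-sym G)) (_~?_ G _ _) (_~?_ G _ _))

adjᵥ-irrefl : (G : Graph) → ∀ x → adjᵥ G x x ≡ 0
adjᵥ-irrefl G x = cong ind (dec-false (_~?_ G _ _) (~-irrefl G refl))

ind≤1 : ∀ b → ind b ≤ 1
ind≤1 false = z≤n
ind≤1 true  = s≤s z≤n

card-∂ : (G : Graph) (X : Vertex G → Bool) →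
  2 * ∣ ∂ G X ∣ ≡ sum₂ λ i j → adjᵥ G i j * dist (X (vertex G i)) (X (vertex G j))
card-∂ G X = card-edgesWhere G (λ u v → ¬? (X u Bool.≟ X v)) ≢-sym

∂-preserves : (G : Graph) (X : Vertex G → Bool) {u v : Vertex G} → Component (G − ∂ G X) u v → X u ≡ X v
∂-preserves G X ε = refl
∂-preserves G X {u} (_◅_ {j = v} (u~v , uv∉∂) path) = trans
  (decidable-stable (X u Bool.≟ X v) λ Xu≢Xv → uv∉∂ (u~v , Xu≢Xv)) (∂-preserves G X path)

∂-isEdgeCut : (G : Graph) (X : Vertex G → Bool) {u v : Vertex G} → X u ≡ true → X v ≡ false → IsEdgeCut G (∂ G X)
∂-isEdgeCut G X Xu Xv conn = contradiction (trans (sym Xu) (trans (∂-preserves G X (conn _ _)) Xv)) λ ()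

neighbour⇒two : (G : Graph) {u v : Vertex G} → _~_ G u v → AtLeastTwo (Component G u)
neighbour⇒two G {u} {v} u~v = u , v , (λ u≡v → ~-irrefl G u≡v u~v) , ε , u~v ◅ ε

-- An edge to a neighbour on the same side survives the removal of the boundary, so no vertex
-- becomes isolated.
∂-isRestrictedEdgeCut : (G : Graph) (X : Vertex G → Bool) {u v : Vertex G} → X u ≡ true → X v ≡ false →
  (∀ w → ∃ λ w′ → _~_ G w w′ × X w ≡ X w′) → IsRestrictedEdgeCut G (∂ G X)
∂-isRestrictedEdgeCut G X Xu Xv partner = ∂-isEdgeCut G X Xu Xv , λ w →
  let w′ , w~w′ , Xw≡Xw′ = partner w in
  neighbour⇒two (G − ∂ G X) (w~w′ , λ (_ , Xw≢Xw′) → Xw≢Xw′ Xw≡Xw′)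

cutWeight-≥ : (G : Graph) {ℓ : ℕ} → IsEdgeConnectivity G ℓ → (B : Fin (order G) → Bool) →
  ∃ (λ x → B x ≡ true) → ∃ (λ x → B x ≡ false) → 2 * ℓ ≤ cutWeight (adjᵥ G) B
cutWeight-≥ G {ℓ} (_ , ℓ-min) B (x , Bx) (y , By) = begin
  2 * ℓ                     ≤⟨ *-monoʳ-≤ 2 (ℓ-min (∂ G X) (∂-isEdgeCut G X (at Bx) (at By))) ⟩
  2 * ∣ ∂ G X ∣             ≡⟨ card-∂ G X ⟩
  sum₂ (λ i j → adjᵥ G i j * dist (X (vertex G i)) (X (vertex G j)))
                            ≡⟨ sum₂-cong (λ i j → cong (adjᵥ G i j *_) (cong₂ dist (at refl) (at refl))) ⟩
  cutWeight (adjᵥ G) B      ∎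
  where
  open ≤-Reasoning
  X : Vertex G → Bool
  X = B ∘ index G
  at : ∀ {i b} → B i ≡ b → X (vertex G i) ≡ b
  at {i} = trans (cong B (index-vertex G i))

-- Reachability is decidable on a finite graph, but its double negation suffices and comes for free.
¬¬-component? : (G : Graph) (u : Vertex G) → ¬ ¬ (∀ v → Dec (Component G u v))
¬¬-component? G u = ¬¬-map (λ component? v → subst (Dec ∘ Component G u) (vertex-index G v) (component? (index G v)))
  (Fin.sequence (RawMonad.rawApplicative ¬¬-Monad) λ i → ¬¬-excluded-middle {A = Component G u (vertex G i)})

-- The side is the component of `o` in `G − S`. Its complement contains the whole component of some
-- unreachable vertex, so both have at least two vertices; an edge leaving the side but not in `S`
-- would enlarge the component.
restrictedEdgeCut-side : (G : Graph) (S : EdgeSet G) → IsRestrictedEdgeCut G S → Vertex G →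
  ¬ ¬ (∃ λ (X : Vertex G → Bool) →
    (∀ b → AtLeastTwo (λ v → X v ≡ b)) × (∀ u v → _~_ G u v → X u ≢ X v → Member S u v))
restrictedEdgeCut-side G S (disconnected , two) o = ¬¬-map side (¬¬-component? (G − S) o)
  where
  reverse : ∀ {u v} → Component (G − S) u v → Component (G − S) v u
  reverse = Star.reverse (~-sym (G − S))
  side : (∀ v → Dec (Component (G − S) o v)) → _
  side component? = X , sides , crossing
    where
    X : Vertex G → Bool
    X v = does (component? v)
    outside : ∃ λ v → ¬ Component (G − S) o v
    outside with i , ¬oi ← Fin.¬∀⟶∃¬ (order G) _ (component? ∘ vertex G) (λ all → disconnected λ u v →
        let reach = λ w → subst (Component (G − S) o) (vertex-index G w) (all (index G w)) in
        reverse (reach u) ◅◅ reach v) = vertex G i , ¬oi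
    sides : ∀ b → AtLeastTwo (λ v → X v ≡ b)
    sides true with u , v , u≢v , ou , ov ← two o =
      u , v , u≢v , dec-true (component? u) ou , dec-true (component? v) ov
    sides false with w , ¬ow ← outside with u , v , u≢v , wu , wv ← two w = u , v , u≢v ,
      dec-false (component? u) (λ ou → ¬ow (ou ◅◅ reverse wu)) ,
      dec-false (component? v) (λ ov → ¬ow (ov ◅◅ reverse wv))
    crossing : ∀ u v → _~_ G u v → X u ≢ X v → Member S u v
    crossing u v u~v Xu≢Xv = decidable-stable (member? S u v) λ uv∉S → Xu≢Xv
      (does-⇔ (mk⇔ (_◅◅ ((u~v , uv∉S) ◅ ε)) (_◅◅ (~-sym (G − S) (u~v , uv∉S) ◅ ε)))
        (component? u) (component? v))

cut≤card : (G : Graph) (S : EdgeSet G) (X : Vertex G → Bool) → (∀ u v → _~_ G u v → X u ≢ X v → Member S u v) →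
  sum₂ (λ i j → adjᵥ G i j * dist (X (vertex G i)) (X (vertex G j))) ≤ 2 * ∣ S ∣
cut≤card G S X crossing = ≤-trans (sum₂-mono λ i j → pointwise (vertex G i) (vertex G j)) (≤-reflexive (sym (card-double S)))
  where
  pointwise : ∀ u v → adj G u v * dist (X u) (X v) ≤ ind (does (member? S u v))
  pointwise u v with _~?_ G u v | X u Bool.≟ X v
  ... | no _    | _         = z≤n
  ... | yes u~v | yes _     = z≤n
  ... | yes u~v | no  Xu≢Xv = ≤-reflexive (sym (cong ind (dec-true (member? S u v) (crossing u v u~v Xu≢Xv))))

neighbour : (G : Graph) → Connected G → Nontrivial G → ∀ u → ∃ (_~_ G u)
neighbour G conn 2≤order u = first-step (conn u (proj₁ other)) (proj₂ other)
  where
  i₀ i₁ : Fin (order G)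
  i₀ = fromℕ< (≤-trans (s≤s z≤n) 2≤order)
  i₁ = fromℕ< 2≤order
  other : ∃ (u ≢_)
  other with _≟_ G u (vertex G i₀)
  ... | no u≢0   = vertex G i₀ , u≢0
  ... | yes refl = vertex G i₁ , λ eq → contradiction
    (trans (sym (Fin.toℕ-fromℕ< _)) (trans (cong toℕ (vertex-injective G eq)) (Fin.toℕ-fromℕ< _))) λ ()
  first-step : ∀ {v} → Component G u v → u ≢ v → ∃ (_~_ G u)
  first-step ε         u≢u = contradiction refl u≢u
  first-step (u~w ◅ _) _   = _ , u~w

sum-adjᵥ : (G : Graph) → sum₂ (adjᵥ G) ≡ 2 * e G
sum-adjᵥ G = sym (card-double (E G))

-- The count behind the lift of an edge set with indicator `s`: columns contain no lifted edge, and
-- each edge has one level lift and two diagonal lifts for every `i`.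
sum-layers : ∀ {m} N (a s : Fin m → Fin m → ℕ) → (∀ x → s x x ≡ 0) → (∀ x y → a x y * s x y ≡ s x y) →
  ∑[ x < m ] ∑[ i < N ] (s x x + s x x) + sum₂ (λ x y → a x y * ∑[ i < N ] (s x y + (s x y + s x y))) ≡ 3 * N * sum₂ s
sum-layers {m} N a s s-irrefl a*s = begin
  ∑[ x < m ] ∑[ i < N ] (s x x + s x x) + sum₂ (λ x y → a x y * ∑[ i < N ] (s x y + (s x y + s x y)))
    ≡⟨ cong₂ _+_
         (trans (sum-cong-≗ λ x → trans (cong (λ t → ∑[ i < N ] (t + t)) (s-irrefl x)) (trans (sum-const N 0) (*-zeroʳ N)))
                (trans (sum-const m 0) (*-zeroʳ m)))
         (sum₂-cong λ x y → trans (cong (a x y *_) (sum-const N (s x y + (s x y + s x y))))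
           (trans (regroup N (a x y) (s x y)) (cong (3 * N *_) (a*s x y)))) ⟩
  sum₂ (λ x y → 3 * N * s x y)
    ≡⟨ sum₂-*ˡ (3 * N) s ⟩
  3 * N * sum₂ s ∎
  where
  open ≡-Reasoning
  regroup : ∀ N a s → a * (N * (s + (s + s))) ≡ 3 * N * (a * s)
  regroup = solve-∀

-- Lower bound for the product with a cycle

module _ (G : Graph) {n : ℕ} (3≤N : 3 ≤ 3 + n) where

  private
    N = 3 + n
    H = G ⊠ cycle N 3≤N

  cut-lower-bound : {ℓ : ℕ} → IsEdgeConnectivity G ℓ →
    (S : EdgeSet H) (X : Vertex H → Bool) →
    (∀ b → AtLeastTwo (λ v → X v ≡ b)) → (∀ u v → _~_ H u v → X u ≢ X v → Member S u v) →
    (3 * N * ℓ) ⊓ (2 * (order G + 2 * e G)) ⊓ (6 * δ G + 2) ≤ ∣ S ∣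
  cut-lower-bound {ℓ} conn S X sides crossing = cases
    (productCut-≥ (adjᵥ G) Y (adjᵥ-sym G) (adjᵥ-irrefl G) (λ x y → ind≤1 _)
      (λ x → ≤-trans (δ≤degree G x) (≤-reflexive (degree-sum G (vertex G x)))) ℓ (cutWeight-≥ G conn) two)
    where
    open ≤-Reasoning
    a = 3 * N * ℓ
    b = 2 * (order G + 2 * e G)
    c = 6 * δ G + 2
    Y : Fin (order G) → Fin N → Bool
    Y x i = X (vertex G x , i)
    two : ∀ b → AtLeastTwo {Fin (order G) × Fin N} (λ (x , i) → Y x i ≡ b)
    two b with (u , i) , (v , j) , ui≢vj , Xui , Xvj ← sides b =
      (index G u , i) , (index G v , j) ,
      (λ eq → ui≢vj (cong₂ _,_
        (trans (sym (vertex-index G u)) (trans (cong (vertex G ∘ proj₁) eq) (vertex-index G v))) (cong proj₂ eq))) ,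
      trans (cong (λ w → X (w , i)) (vertex-index G u)) Xui ,
      trans (cong (λ w → X (w , j)) (vertex-index G v)) Xvj
    halve : ∀ {k} → 2 * k ≤ productCut (adjᵥ G) Y → k ≤ ∣ S ∣
    halve {k} 2k≤ = *-cancelˡ-≤ 2 (begin
      2 * k                     ≤⟨ 2k≤ ⟩
      productCut (adjᵥ G) Y     ≡⟨ cut-⊠-cycle G 3≤N X ⟨
      sum₂ (λ k l → adjᵥ H k l * dist (X (vertex H k)) (X (vertex H l)))
                                ≤⟨ cut≤card H S X crossing ⟩
      2 * ∣ S ∣                 ∎)
    arith : ∀ m e → 2 * (2 * (m + 2 * e)) ≡ 4 * m + 4 * (2 * e)
    arith = solve-∀
    cases : 2 * a ≤ productCut (adjᵥ G) Y ⊎ 4 * order G + 4 * sum₂ (adjᵥ G) ≤ productCut (adjᵥ G) Y ⊎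
            2 * c ≤ productCut (adjᵥ G) Y → a ⊓ b ⊓ c ≤ ∣ S ∣
    cases (inj₁ 2a≤)        = ≤-trans (m⊓n≤m (a ⊓ b) c) (≤-trans (m⊓n≤m a b) (halve {a} 2a≤))
    cases (inj₂ (inj₁ 2b≤)) = ≤-trans (m⊓n≤m (a ⊓ b) c) (≤-trans (m⊓n≤n a b) (halve {b} (≤-trans
      (≤-reflexive (trans (arith (order G) (e G)) (cong (λ s → 4 * order G + 4 * s) (sym (sum-adjᵥ G))))) 2b≤)))
    cases (inj₂ (inj₂ 2c≤)) = ≤-trans (m⊓n≤n (a ⊓ b) c) (halve {c} 2c≤)

  -- Three restricted edge-cuts for the upper bound

  RestrictedCut≤ : ℕ → Set₁
  RestrictedCut≤ k = Σ[ S ∈ EdgeSet H ] (IsRestrictedEdgeCut H S × ∣ S ∣ ≤ k)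

  ∂-restrictedCut≤ : (X : Vertex H → Bool) {u v : Vertex H} → X u ≡ true → X v ≡ false →
    (∀ w → ∃ λ w′ → _~_ H w w′ × X w ≡ X w′) →
    ∀ k → productCut (adjᵥ G) (λ x i → X (vertex G x , i)) ≤ 2 * k → RestrictedCut≤ k
  ∂-restrictedCut≤ X Xu Xv partner k cut≤2k = ∂ H X , ∂-isRestrictedEdgeCut H X Xu Xv partner , *-cancelˡ-≤ 2 (begin
    2 * ∣ ∂ H X ∣  ≡⟨ card-∂ H X ⟩
    sum₂ (λ k l → adjᵥ H k l * dist (X (vertex H k)) (X (vertex H l)))
                   ≡⟨ cut-⊠-cycle G 3≤N X ⟩
    productCut (adjᵥ G) (λ x i → X (vertex G x , i))
                   ≤⟨ cut≤2k ⟩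
    2 * k          ∎)
    where open ≤-Reasoning

  first : Fin N → Bool
  first zero    = true
  first (suc _) = false

  firstTwo : Fin N → Bool
  firstTwo zero          = true
  firstTwo (suc zero)    = true
  firstTwo (suc (suc _)) = false

  -- The terms at 0, 1 and 2 are found by computation, and the remaining `n` terms vanish; the three
  -- computations that follow work the same way.
  boundary-first : boundary first ≡ 2
  boundary-first = cong (2 +_) (trans (sum-const n 0) (*-zeroʳ n))

  cross-first : cross first first ≡ 4
  cross-first = cong (4 +_) (trans (sum-const n 0) (*-zeroʳ n))

  boundary-firstTwo : ∀ c → boundary (λ i → c ∧ firstTwo i) ≡ ind c * 2
  boundary-firstTwo false = trans (sum-const N 0) (*-zeroʳ N)
  boundary-firstTwo true  = cong (2 +_) (trans (sum-const n 0) (*-zeroʳ n))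

  cross-firstTwo : ∀ c c′ → cross (λ i → c ∧ firstTwo i) (λ i → c′ ∧ firstTwo i) ≤ 6 * (ind c + ind c′)
  cross-firstTwo false false = ≤-reflexive (trans (sum-const N 0) (*-zeroʳ N))
  cross-firstTwo false true  = ≤-reflexive (cong (6 +_) (trans (sum-const n 0) (*-zeroʳ n)))
  cross-firstTwo true  false = ≤-reflexive (cong (6 +_) (trans (sum-const n 0) (*-zeroʳ n)))
  -- The gap between 4 and 12 is harmless: both flags are true only for a column paired with itself,
  -- and no column is adjacent to itself.
  cross-firstTwo true  true  = ≤-trans (≤-reflexive (cong (4 +_) (trans (sum-const n 0) (*-zeroʳ n)))) (m≤m+n 4 8)

  cycle-prev : ∀ x i → _~_ H (x , i) (x , prev i)
  cycle-prev x i = inj₁ (refl , inj₂ (prev-Next i))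

  -- The side is the layer over 0. Each vertex has a neighbour of G in its own layer, hence on its
  -- own side; every column has boundary 2, and adjacent columns span 4 cut edges.
  layer-cut : Connected G → Nontrivial G → Vertex G → RestrictedCut≤ (2 * (order G + 2 * e G))
  layer-cut conn nontrivial o = ∂-restrictedCut≤ (first ∘ proj₂) {o , zero} {o , suc zero} refl refl
    (λ (x , i) → let y , x~y = neighbour G conn nontrivial x in (y , i) , inj₂ (inj₁ (refl , x~y)) , refl)
    (2 * (order G + 2 * e G)) (≤-reflexive (begin
      ∑[ x < order G ] (2 * boundary first) + sum₂ (λ x y → adjᵥ G x y * cross first first)
        ≡⟨ cong₂ _+_ (sum-const (order G) (2 * boundary first)) (sum₂-*ʳ (cross first first) (adjᵥ G)) ⟩
      order G * (2 * boundary first) + sum₂ (adjᵥ G) * cross first first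
        ≡⟨ cong₂ (λ p q → order G * (2 * p) + sum₂ (adjᵥ G) * q) boundary-first cross-first ⟩
      order G * 4 + sum₂ (adjᵥ G) * 4
        ≡⟨ cong (λ s → order G * 4 + s * 4) (sum-adjᵥ G) ⟩
      order G * 4 + 2 * e G * 4
        ≡⟨ arith (order G) (e G) ⟩
      2 * (2 * (order G + 2 * e G)) ∎))
    where
    open ≡-Reasoning
    arith : ∀ m e → m * 4 + 2 * e * 4 ≡ 2 * (2 * (m + 2 * e))
    arith = solve-∀

  -- The side consists of the points over 0 and 1 of the column of a vertex `u` of minimum degree.
  edge-cut : Connected G → Nontrivial G → Vertex G → RestrictedCut≤ (6 * δ G + 2)
  edge-cut conn nontrivial o with u , deg≤δ ← δ-attained G o = ∂-restrictedCut≤ X {u , zero} {u , suc (suc zero)}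
    (cong (_∧ true) (dec-true (_≟_ G u u) refl)) (Bool.∧-zeroʳ (does (_≟_ G u u))) partner (6 * δ G + 2) (begin
      ∑[ x < order G ] (2 * boundary (λ i → does (vertex G x ≟ᴳ u) ∧ firstTwo i)) +
      sum₂ (λ x y → adjᵥ G x y *
        cross (λ i → does (vertex G x ≟ᴳ u) ∧ firstTwo i) (λ i → does (vertex G y ≟ᴳ u) ∧ firstTwo i))
        ≤⟨ +-mono-≤
             (≤-reflexive (sum-cong-≗ λ x → trans (cong (2 *_) (boundary-firstTwo (does (vertex G x ≟ᴳ u))))
               (double-2 (ν x))))
             (sum₂-mono λ x y → ≤-trans
               (*-monoʳ-≤ (adjᵥ G x y) (cross-firstTwo (does (vertex G x ≟ᴳ u)) (does (vertex G y ≟ᴳ u))))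
               (≤-reflexive (swap-6 (adjᵥ G x y) (ν x + ν y)))) ⟩
      ∑[ x < order G ] (ν x * 4) + sum₂ (λ x y → 6 * (adjᵥ G x y * (ν x + ν y)))
        ≡⟨ cong₂ _+_ (sum-ν (λ _ → 4)) (trans (sum₂-*ˡ 6 (λ x y → adjᵥ G x y * (ν x + ν y)))
             (cong (6 *_) (sum-weighted (adjᵥ G) (adjᵥ-sym G) ν))) ⟩
      4 + 6 * (2 * ∑[ x < order G ] (ν x * sum (adjᵥ G x)))
        ≡⟨ cong (λ s → 4 + 6 * (2 * s)) (sum-ν (λ x → sum (adjᵥ G x))) ⟩
      4 + 6 * (2 * sum (adjᵥ G (index G u)))
        ≡⟨ cong (λ s → 4 + 6 * (2 * s)) (trans (sym (degree-sum G (vertex G (index G u))))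
             (cong (degree G) (vertex-index G u))) ⟩
      4 + 6 * (2 * degree G u)
        ≤⟨ +-monoʳ-≤ 4 (*-monoʳ-≤ 6 (*-monoʳ-≤ 2 deg≤δ)) ⟩
      4 + 6 * (2 * δ G)
        ≡⟨ arith (δ G) ⟩
      2 * (6 * δ G + 2) ∎)
    where
    open ≤-Reasoning
    _≟ᴳ_ = _≟_ G
    X : Vertex H → Bool
    X (x , i) = does (x ≟ᴳ u) ∧ firstTwo i
    ν : Fin (order G) → ℕ
    ν x = ind (does (vertex G x ≟ᴳ u))
    sum-ν : ∀ f → ∑[ x < order G ] (ν x * f x) ≡ f (index G u)
    sum-ν f = sum-select (λ x → vertex G x ≟ᴳ u) f (index G u) (vertex-index G u)
      λ { {x} refl → sym (index-vertex G x) }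
    double-2 : ∀ v → 2 * (v * 2) ≡ v * 4
    double-2 = solve-∀
    swap-6 : ∀ a s → a * (6 * s) ≡ 6 * (a * s)
    swap-6 = solve-∀
    arith : ∀ d → 4 + 6 * (2 * d) ≡ 2 * (6 * d + 2)
    arith = solve-∀
    -- The points over 0 and 1 of any column are partners of each other; all other points are
    -- outside the side, together with a neighbour in their own layer.
    partner : ∀ w → ∃ λ w′ → _~_ H w w′ × X w ≡ X w′
    partner (x , zero)     = (x , suc zero) , ~-sym H {x , suc zero} {x , zero} (cycle-prev x (suc zero)) , refl
    partner (x , suc zero) = (x , zero) , cycle-prev x (suc zero) , refl
    partner (x , suc (suc i)) with y , x~y ← neighbour G conn nontrivial x =
      (y , suc (suc i)) , inj₂ (inj₁ (refl , x~y)) ,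
      trans (Bool.∧-zeroʳ (does (x ≟ᴳ u))) (sym (Bool.∧-zeroʳ (does (y ≟ᴳ u))))

  lift : EdgeSet G → EdgeSet H
  lift S = edgesWhere H {λ u v → Member S (proj₁ u) (proj₁ v)} (λ u v → member? S (proj₁ u) (proj₁ v)) (member-sym S)

  card-lift : (S : EdgeSet G) → 2 * ∣ lift S ∣ ≡ 2 * (3 * N * ∣ S ∣)
  card-lift S = begin
    2 * ∣ lift S ∣
      ≡⟨ card-edgesWhere H {λ u v → Member S (proj₁ u) (proj₁ v)} (λ u v → member? S (proj₁ u) (proj₁ v)) (member-sym S) ⟩
    sum₂ (λ k l → adjᵥ H k l * h (vertex H k) (vertex H l))
      ≡⟨ sum-⊠-cycle G 3≤N h ⟩
    ∑[ x < order G ] ∑[ i < N ] (s x x + s x x) + sum₂ (λ x y → adjᵥ G x y * ∑[ i < N ] (s x y + (s x y + s x y)))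
      ≡⟨ sum-layers N (adjᵥ G) s s-irrefl adj*s ⟩
    3 * N * sum₂ s
      ≡⟨ cong (3 * N *_) (card-double S) ⟨
    3 * N * (2 * ∣ S ∣)
      ≡⟨ arith (3 * N) ∣ S ∣ ⟩
    2 * (3 * N * ∣ S ∣) ∎
    where
    open ≡-Reasoning
    h : Vertex H → Vertex H → ℕ
    h u v = ind (does (member? S (proj₁ u) (proj₁ v)))
    s : Fin (order G) → Fin (order G) → ℕ
    s x y = ind (does (member? S (vertex G x) (vertex G y)))
    s-irrefl : ∀ x → s x x ≡ 0
    s-irrefl x = cong ind (dec-false (member? S _ _) (~-irrefl G refl ∘ member⇒~ S))
    adj*s : ∀ x y → adjᵥ G x y * s x y ≡ s x y
    adj*s x y with member? S (vertex G x) (vertex G y)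
    ... | no _    = *-zeroʳ (adjᵥ G x y)
    ... | yes x∈S = cong (λ b → ind b * 1) (dec-true (_~?_ G _ _) (member⇒~ S x∈S))
    arith : ∀ c ℓ → c * (2 * ℓ) ≡ 2 * (c * ℓ)
    arith = solve-∀

  -- A path avoiding the lift projects to a path avoiding `S`. Column edges project to a single
  -- vertex and are not lifted, so every vertex keeps its neighbours in its column.
  lift-isRestrictedEdgeCut : (S : EdgeSet G) → IsEdgeCut G S → IsRestrictedEdgeCut H (lift S)
  lift-isRestrictedEdgeCut S disconnected =
    (λ conn → disconnected λ x y → project (conn (x , zero) (y , zero))) ,
    λ (x , i) → neighbour⇒two (H − lift S) (cycle-prev x i , λ (_ , xx∈S) → ~-irrefl G refl (member⇒~ S xx∈S))
    where
    project : ∀ {u v} → Component (H − lift S) u v → Component (G − S) (proj₁ u) (proj₁ v)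
    project ε = ε
    project ((inj₁ (refl , _) , _) ◅ path)             = project path
    project ((p@(inj₂ (inj₁ (_ , x~y))) , ∉lift) ◅ path) = (x~y , λ ∈S → ∉lift (p , ∈S)) ◅ project path
    project ((p@(inj₂ (inj₂ (x~y , _))) , ∉lift) ◅ path) = (x~y , λ ∈S → ∉lift (p , ∈S)) ◅ project path

  lift-cut : {ℓ : ℕ} → IsEdgeConnectivity G ℓ → RestrictedCut≤ (3 * N * ℓ)
  lift-cut {ℓ} ((S , disconnected , S≡ℓ) , _) = lift S , lift-isRestrictedEdgeCut S disconnected ,
    *-cancelˡ-≤ {∣ lift S ∣} {3 * N * ℓ} 2 (≤-reflexive (trans (card-lift S) (cong (λ k → 2 * (3 * N * k)) S≡ℓ)))

  restrictedCut≤-⊓ : ∀ {j k} → RestrictedCut≤ j → RestrictedCut≤ k → RestrictedCut≤ (j ⊓ k)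
  restrictedCut≤-⊓ {j} {k} cutⱼ cutₖ with ⊓-sel j k
  ... | inj₁ eq = subst RestrictedCut≤ (sym eq) cutⱼ
  ... | inj₂ eq = subst RestrictedCut≤ (sym eq) cutₖ

  ⊠-cycle-connectivity : Connected G → Nontrivial G → {ℓ : ℕ} → IsEdgeConnectivity G ℓ →
    IsRestrictedEdgeConnectivity H ((3 * N * ℓ) ⊓ (2 * (order G + 2 * e G)) ⊓ (6 * δ G + 2))
  ⊠-cycle-connectivity conn nontrivial {ℓ} ℓ-conn = attained cut , lower
    where
    k = (3 * N * ℓ) ⊓ (2 * (order G + 2 * e G)) ⊓ (6 * δ G + 2)
    o : Vertex G
    o = vertex G (fromℕ< nontrivial)
    lower : ∀ S → IsRestrictedEdgeCut H S → k ≤ ∣ S ∣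
    -- The side of the cut is available only under a double negation, which the decidable inequality
    -- absorbs.
    lower S S-cut = decidable-stable (k ≤? ∣ S ∣) (¬¬-map
      (λ (X , sides , crossing) → cut-lower-bound ℓ-conn S X sides crossing)
      (restrictedEdgeCut-side H S S-cut (o , zero)))
    cut : RestrictedCut≤ k
    cut = restrictedCut≤-⊓ {(3 * N * ℓ) ⊓ (2 * (order G + 2 * e G))} {6 * δ G + 2}
      (restrictedCut≤-⊓ {3 * N * ℓ} {2 * (order G + 2 * e G)} (lift-cut ℓ-conn) (layer-cut conn nontrivial o))
      (edge-cut conn nontrivial o)
    -- The constructions only need to bound the size from above; equality follows from the lower
    -- bound for the same cut.
    attained : RestrictedCut≤ k → Σ[ S ∈ EdgeSet H ] (IsRestrictedEdgeCut H S × ∣ S ∣ ≡ k)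
    attained (S , S-cut , S≤k) = S , S-cut , ≤-antisym S≤k (lower S S-cut)

theorem3p4 : (G : Graph) → Connected G → Nontrivial G →
    (m : ℕ) → Graph.order G ≡ m →
    (n : ℕ) (n≥3 : 3 ≤ n) →
    (ℓ : ℕ) → IsEdgeConnectivity G ℓ →
    IsRestrictedEdgeConnectivity (G ⊠ cycle n n≥3)
    ((3 * n * ℓ) ⊓ (2 * (m + 2 * e G)) ⊓ (6 * δ G + 2))
-- Matching on the proof of 3 ≤ n brings n into the form 3 + k used for the cycle.
theorem3p4 G conn nontrivial _ refl _ n≥3@(s≤s (s≤s (s≤s z≤n))) ℓ ℓ-conn =
  ⊠-cycle-connectivity G n≥3 conn nontrivial ℓ-conn
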